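{- For every $m\ge1$, the sequences $\big(\#R_n(1/2/\ldots/m)\big)_{n\ge0}$ and $\big(\#R_n(12\ldots m)\big)_{n\ge0}$ are P-recursive. Furthermore, for every partition $\pi$ of $[3]$, the sequence $\big(\#R_n(\pi)\big)_{n\ge0}$ is P-recursive.
   Context: $\Pi_n$ is the set of partitions of $[n]$. A partition $B_1/\ldots/B_k$ is in canonical order if $\min B_1<\cdots<\min B_k$; its restricted growth function is $\rho(\pi)=a_1\ldots a_n$ where $a_i$ is the index of the block containing $i$. A sequence contains $r$ if some subsequence standardizes (order-preserving relabeling of values onto $1,2,\ldots$) to $r$. $\sigma$ R-avoids $\pi$ if $\rho(\sigma)$ does not contain $\rho(\pi)$; $R_n(\pi)$ is the set of $\sigma\in\Pi_n$ R-avoiding $\pi$. A sequence $(a_n)$ is P-recursive if there are polynomials $P_0,\ldots,P_k$, not all zero, with $\sum_{i=0}^kP_i(n)a_{n+i}=0$ for all $n\ge0$. -}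

module Defs where

open import Data.Fin.Base as Fin using (Fin; zero; toℕ)
open import Data.Fin.Subset using (Subset; _∈_; _∩_; Nonempty; Empty; ⁅_⁆; ⊤)
open import Data.Fin.Subset.Properties
  using (x∈⁅x⁆; x∈⁅y⁆⇒x≡y; x∈p∩q⁻; ∈⊤)
open import Data.Integer.Base as ℤ using (ℤ; +_; 0ℤ)
import Data.Integer.Properties as ℤ
open import Algebra.Properties.Monoid.Sum ℤ.+-0-monoid using (sum⁺-syntax)
open import Data.List.Base
  using (List; []; _∷_; map; foldr; filter; length; deduplicate; tabulate)
open import Data.List.Relation.Binary.Sublist.Propositional using (_⊆_)
open import Data.List.Relation.Unary.All using (All; []; _∷_)
import Data.List.Relation.Unary.All.Properties as All
open import Data.List.Relation.Unary.AllPairs using (AllPairs; []; _∷_)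
import Data.List.Relation.Unary.AllPairs.Properties as AllPairs
open import Data.List.Relation.Unary.Any using (Any; here; index)
import Data.List.Relation.Unary.Any.Properties as Any
open import Data.Nat.Base as ℕ using (ℕ; suc; NonZero)
import Data.Nat.Properties as ℕ
open import Data.Product.Base using (∃-syntax; Σ-syntax; _×_; _,_)
open import Function.Bundles using (Inverse)
open import Level using (0ℓ)
open import Relation.Binary.Bundles using (Setoid)
import Relation.Binary.Construct.On as On
open import Relation.Binary.PropositionalEquality
  using (_≡_; sym; trans; subst₂; setoid)
open import Relation.Nullary.Negation using (¬_)

IsMin : ∀ {n} → Subset n → Fin n → Set
IsMin B x = x ∈ B × (∀ y → y ∈ B → x Fin.≤ y)

-- Both minima exist and are unique for the nonempty blocks to which this is
-- applied, so quantifying over them universally is harmless.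
_<min_ : ∀ {n} → Subset n → Subset n → Set
B <min C = ∀ x y → IsMin B x → IsMin C y → x Fin.< y

-- The ground set [n] is Fin n, with i : Fin n standing for the element i + 1.
-- A set partition is represented by the list of its blocks in canonical order;
-- every set partition has exactly one such listing.
record Partition (n : ℕ) : Set where
  field
    blocks    : List (Subset n)
    nonempty  : All Nonempty blocks
    disjoint  : AllPairs (λ B C → Empty (B ∩ C)) blocks
    cover     : ∀ x → Any (x ∈_) blocks
    canonical : AllPairs _<min_ blocks

open Partition public

-- By disjointness the index does not depend on the proof `cover π x`.
ρ : ∀ {n} → Partition n → List ℕ
ρ π = tabulate (λ x → suc (toℕ (index (cover π x))))

-- Each entry is replaced by its rank among the distinct values that occur.
-- This is the only order-preserving relabelling of these values onto 1, …, t.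
standardize : List ℕ → List ℕ
standardize s = map rank s
  where
  rank : ℕ → ℕ
  rank v = length (filter (ℕ._≤? v) (deduplicate ℕ._≟_ s))

Contains : List ℕ → List ℕ → Set
Contains w r = ∃[ s ] (s ⊆ w × standardize s ≡ r)

RAvoids : ∀ {n m} → Partition n → Partition m → Set
RAvoids σ π = ¬ Contains (ρ σ) (ρ π)

-- Equality in R n π is equality of the canonically ordered block lists, so the
-- proof components of a partition and of avoidance play no role.
R : ∀ (n : ℕ) {m} → Partition m → Setoid 0ℓ 0ℓ
R n π = On.setoid {B = Σ[ σ ∈ Partition n ] RAvoids σ π}
                  (setoid (List (Subset n))) (λ (σ , _) → blocks σ)

HasCardinality : Setoid 0ℓ 0ℓ → ℕ → Set
HasCardinality S c = Inverse S (setoid (Fin c))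

-- Coefficients, constant term first; trailing zeros are allowed.
Poly : Set
Poly = List ℤ

eval : Poly → ℤ → ℤ
eval p x = foldr (λ c v → c ℤ.+ x ℤ.* v) 0ℤ p

IsZero : Poly → Set
IsZero = All (_≡ 0ℤ)

-- For integer sequences, recurrences with coefficients in ℤ[x], in ℚ[x] and in
-- K[x] for any field K ⊇ ℚ define the same notion.
PRecursive : (ℕ → ℤ) → Set
PRecursive a =
  ∃[ k ] Σ[ P ∈ (Fin (suc k) → Poly) ]
    ¬ (∀ i → IsZero (P i)) ×
    (∀ n → ∑[ i ≤ k ] (eval (P i) (+ n) ℤ.* a (n ℕ.+ toℕ i)) ≡ 0ℤ)

-- The sequence a below is determined by π, since cardinalities are unique.
PRecursive-#R : ∀ {m} → Partition m → Set
PRecursive-#R π =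
  Σ[ a ∈ (ℕ → ℕ) ]
    (∀ n → HasCardinality (R n π) (a n)) × PRecursive (λ n → + a n)

-- 1/2/…/m
singletons : ∀ m → Partition m
singletons m = record
  { blocks    = tabulate ⁅_⁆
  ; nonempty  = All.tabulate⁺ (λ i → i , x∈⁅x⁆ i)
  ; disjoint  = AllPairs.tabulate⁺ λ {i} {j} i≢j (x , x∈) →
      let (x∈i , x∈j) = x∈p∩q⁻ ⁅ i ⁆ ⁅ j ⁆ x∈
      in i≢j (trans (sym (x∈⁅y⁆⇒x≡y i x∈i)) (x∈⁅y⁆⇒x≡y j x∈j))
  ; cover     = λ x → Any.tabulate⁺ x (x∈⁅x⁆ x)
  ; canonical = AllPairs.tabulate⁺-< λ {i} {j} i<j x y (x∈i , _) (y∈j , _) →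
      subst₂ Fin._<_ (sym (x∈⁅y⁆⇒x≡y i x∈i)) (sym (x∈⁅y⁆⇒x≡y j y∈j)) i<j
  }

-- 12…m
oneBlock : ∀ m .{{_ : NonZero m}} → Partition m
oneBlock (suc m) = record
  { blocks    = ⊤ ∷ []
  ; nonempty  = (zero , ∈⊤) ∷ []
  ; disjoint  = [] ∷ []
  ; cover     = λ x → here ∈⊤
  ; canonical = [] ∷ []
  }

{-# OPTIONS --safe #-}

-- Restricted growth functions correspond to partitions.  For each pattern, the
-- avoiding words are those readable by an automaton whose state remembers what
-- the prefix read so far forbids, so #R_n counts paths of length n.
--
-- 1/2/…/m: the state is the number k < m of blocks.  Applying E − k, where E is
-- the shift, turns the count from k into the count from k + 1, so the product
-- of the E − k annihilates the sequence.
--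
-- 12…m: the state lists the remaining capacities of the blocks.  Splitting off
-- the elements of one block gives a(n+1) = Σ_{i ≤ m-2} C(n,i) a(n-i), and
-- (m-2)! C(n,i) is a polynomial in n.
--
-- 12/3, 13/2, 1/23: there are 2^(n-1) avoiding words for n ≥ 1.
module Submission where

open import Defs
open import Data.Bool.Base using (true; false; T)
open import Data.Fin.Base as Fin using (Fin; zero; suc; toℕ; fromℕ<)
import Data.Fin.Properties as Fin
open import Data.Fin.Subset using (Subset; _∩_; Nonempty; Empty; ⁅_⁆) renaming (_∈_ to _∈ₛ_)
open import Data.Fin.Subset.Properties using (x∈p∩q⁺; x∈p∩q⁻; ⊆-antisym)
open import Data.Integer.Base as ℤ using (ℤ; +_; 0ℤ; 1ℤ)
import Data.Integer.Properties as ℤ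
open import Data.Integer.Tactic.RingSolver using () renaming (solve-∀ to ring)
open import Algebra.Properties.Monoid.Sum ℤ.+-0-monoid using ()
  renaming (sum to sumℤ; sum-cong-≗ to sum-cong)
open import Data.List.Base as List
  using (List; []; _∷_; _++_; _∷ʳ_; [_]; map; length; concatMap; applyUpTo; upTo; filter;
         deduplicate; replicate; tabulate)
open import Data.List.Membership.Propositional using (_∈_; find)
open import Data.List.Membership.Propositional.Properties
  using (∈-lookup; ∈-map⁺; ∈-map⁻; ∈-concatMap⁺; ∈-concatMap⁻; ∈-upTo⁺; ∈-upTo⁻; ∈-++⁺ʳ; ∈-++⁻;
         ∈-deduplicate⁺)
open import Data.List.Properties
  using (map-∘; map-cong; map-cong-local; map-id; map-++; map-replicate; map-tabulate; map-upTo;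
         length-map; length-++; length-upTo; length-replicate; filter-all; filter-++;
         filter-accept; filter-reject; ++-identityʳ; ∷ʳ-++; ∷-injective; ∷-injectiveˡ;
         upTo-∷ʳ; tabulate-cong; tabulate-lookup)
open import Data.List.Relation.Binary.Sublist.Propositional
  using (_⊆_; []; _∷_; ⊆-refl; ⊆-trans; minimum; from∈)
import Data.List.Relation.Binary.Sublist.Propositional as Sublist
open import Data.List.Relation.Binary.Sublist.Propositional.Properties
  using (++⁺; ++⁺ʳ; map⁺; All-resp-⊆; ∷ˡ⁻; filter-⊆; filter⁺; length-mono-≤)
open import Data.List.Relation.Unary.All as All using (All; []; _∷_)
import Data.List.Relation.Unary.All.Properties as All
open import Data.List.Relation.Unary.AllPairs as AllPairs using (AllPairs; []; _∷_)
import Data.List.Relation.Unary.AllPairs.Properties as AllPairs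
open import Data.List.Relation.Unary.Any as Any using (Any; here; there; index)
import Data.List.Relation.Unary.Any.Properties as Any
open import Data.List.Relation.Unary.Unique.Propositional using (Unique)
import Data.List.Relation.Unary.Unique.Propositional.Properties as Unique
open import Data.Nat.Base
  using (ℕ; zero; suc; _+_; _*_; _^_; _∸_; _⊔_; _!; _≤_; _<_; z≤n; s≤s; s≤s⁻¹; NonZero)
open import Data.Nat.Combinatorics
  using (_C_; nCk+nC[k+1]≡[n+1]C[k+1]; k>n⇒nCk≡0; nCn≡1; nCk≡nC[n∸k])
open import Data.Nat.ListAction using (sum)
open import Data.Nat.ListAction.Properties using (sum-++)
import Data.Nat.Properties as ℕ
open import Data.Nat.Tactic.RingSolver using (solve-∀)
open import Data.Product.Base using (∃-syntax; _×_; _,_; proj₁; proj₂)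
open import Data.Sum.Base using (_⊎_; inj₁; inj₂; [_,_]′)
open import Data.Unit.Base using (⊤; tt)
open import Data.Vec.Base as Vec using (Vec; []; _∷_; toList)
import Data.Vec.Properties as Vec
open import Function.Base using (_∘_; id)
open import Relation.Binary.Core using (Rel; _Preserves_⟶_)
open import Relation.Binary.Definitions using (tri<; tri≈; tri>)
open import Relation.Binary.PropositionalEquality
  using (_≡_; _≢_; refl; sym; trans; cong; cong₂; subst; module ≡-Reasoning)
open import Relation.Nullary.Decidable using (yes; no; does; ¬?; dec-true)
open import Relation.Nullary.Negation using (¬_; contradiction)
import Relation.Unary as U

-- Containment is defined up to standardization, so a pattern could be met in any letters. What
-- tames it is that the first occurrences of the letters of a restricted growth word come in the
-- order 0, 1, 2, ...: once k letters are in use, every increasing sequence of letters below k is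
-- already a subsequence. Each pattern thus turns into a concrete predicate `Bad` on words, and a
-- small state tells which letters may follow.
--
-- The powers of 2 have two sources. For 13/2 and 1/23 every state past the first has exactly two
-- transitions. For 12/3 the branching grows with the state, and doubling emerges only from a
-- Pascal-like relation between neighbouring states.
--
-- The recurrences must hold from n = 0 on, with integer coefficients. They are therefore moved
-- forward until no index is truncated, denominators are cleared by a factorial, and an irregular
-- initial value receives the coefficient zero.

private
  variable
    k m n u v x y : ℕ
    p s w : List ℕ

-- Partitions and restricted growth functions

-- Letters are numbered from 0: the word of π is ρ π with every entry lowered
-- by one.  In RGF k w, the number k counts the letters used before w.
RGF : ℕ → List ℕ → Set
RGF k []      = ⊤
RGF k (x ∷ w) = x ≤ k × RGF (k ⊔ suc x) w

-- The growth condition told by positions. The canonical order of blocks yields it directly, whereas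
-- the recursive `RGF` suits reading a word letter by letter.
FirstOccurrencesOrdered : ℕ → (Fin n → ℕ) → Set
FirstOccurrencesOrdered k f =
  ∀ i j → k ≤ j → j < f i → ∃[ i′ ] (i′ Fin.< i × f i′ ≡ j)

rgf⁺ : (f : Fin n → ℕ) → FirstOccurrencesOrdered k f → RGF k (tabulate f)
rgf⁺ {zero}      f o = tt
rgf⁺ {suc n} {k} f o = ℕ.≮⇒≥ head≤ , rgf⁺ (f ∘ suc) ordered
  where
  head≤ : ¬ (k < f zero)
  head≤ k<f₀ with o zero k ℕ.≤-refl k<f₀
  ... | _ , () , _

  ordered : FirstOccurrencesOrdered (k ⊔ suc (f zero)) (f ∘ suc)
  ordered i j k′≤j j<fi with o (suc i) j (ℕ.m⊔n≤o⇒m≤o _ _ k′≤j) j<fi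
  ... | zero   , _    , refl = contradiction (ℕ.m⊔n≤o⇒n≤o k _ k′≤j) ℕ.1+n≰n
  ... | suc i′ , i′<i , eq   = i′ , s≤s⁻¹ i′<i , eq

rgf⁻ : (f : Fin n → ℕ) → RGF k (tabulate f) → FirstOccurrencesOrdered k f
rgf⁻ f (f₀≤k , _) zero j k≤j j<f₀ =
  contradiction (ℕ.≤-trans j<f₀ (ℕ.≤-trans f₀≤k k≤j)) ℕ.1+n≰n
rgf⁻ {k = k} f (f₀≤k , r) (suc i) j k≤j j<fi with (k ⊔ suc (f zero)) ℕ.≤? j
... | yes k′≤j =
  let (i′ , i′<i , eq) = rgf⁻ (f ∘ suc) r i j k′≤j j<fi in suc i′ , s≤s i′<i , eq
-- Here `k ≤ j < k ⊔ suc (f zero)` and `f zero ≤ k`, so `j` can only be `f zero`.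
... | no k′≰j = zero , s≤s z≤n , ℕ.≤-antisym (ℕ.≤-trans f₀≤k k≤j) j≤f₀
  where
  j≤f₀ : j ≤ f zero
  j≤f₀ = ℕ.≮⇒≥ λ f₀<j → k′≰j (ℕ.⊔-lub k≤j f₀<j)

-- The number of blocks to be built: a restricted growth function attains every letter below it
-- (`height-onto`).
height : (Fin n → ℕ) → ℕ
height {zero}  f = 0
height {suc n} f = suc (f zero) ⊔ height (f ∘ suc)

f<height : (f : Fin n → ℕ) → ∀ i → f i < height f
f<height f zero    = ℕ.m≤m⊔n (suc (f zero)) (height (f ∘ suc))
f<height f (suc i) = ℕ.≤-trans (f<height (f ∘ suc) i) (ℕ.m≤n⊔m (suc (f zero)) (height (f ∘ suc)))

height-attained : (f : Fin n → ℕ) → ∀ j → j < height f → ∃[ i ] j ≤ f i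
height-attained {suc n} f j j<h with ℕ.⊔-sel (suc (f zero)) (height (f ∘ suc))
... | inj₁ eq = zero , s≤s⁻¹ (subst (j <_) eq j<h)
... | inj₂ eq = let (i , j≤) = height-attained (f ∘ suc) j (subst (j <_) eq j<h) in suc i , j≤

height-onto : (f : Fin n → ℕ) → FirstOccurrencesOrdered 0 f →
              ∀ j → j < height f → ∃[ i ] f i ≡ j
height-onto f o j j<h with height-attained f j j<h
... | i , j≤fi with ℕ.m≤n⇒m<n∨m≡n j≤fi
...   | inj₂ eq   = i , sym eq
...   | inj₁ j<fi = let (i′ , _ , eq) = o i j z≤n j<fi in i′ , eq

height≡ : (f : Fin n → ℕ) → (∀ i → f i < k) → (∀ j → j < k → ∃[ i ] f i ≡ j) → height f ≡ k
height≡ {k = k} f bound onto = ℕ.≤-antisym (ℕ.≮⇒≥ k≮) (ℕ.≮⇒≥ h≮)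
  where
  k≮ : ¬ (k < height f)
  k≮ k<h = let (i , k≤fi) = height-attained f k k<h in ℕ.<⇒≱ (bound i) k≤fi
  h≮ : ¬ (height f < k)
  h≮ h<k = let (i , eq) = onto _ h<k in ℕ.<-irrefl eq (f<height f i)

fibre : (Fin n → ℕ) → ℕ → Subset n
fibre f j = Vec.tabulate (λ i → does (f i ℕ.≟ j))

∈-fibre⁺ : ∀ (f : Fin n → ℕ) {i j} → f i ≡ j → i ∈ₛ fibre f j
∈-fibre⁺ f {i} {j} eq =
  Vec.lookup⇒[]= i _ (trans (Vec.lookup∘tabulate _ i) (dec-true (f i ℕ.≟ j) eq))

∈-fibre⁻ : ∀ (f : Fin n → ℕ) {i j} → i ∈ₛ fibre f j → f i ≡ j
∈-fibre⁻ f {i} {j} i∈ = ℕ.≡ᵇ⇒≡ (f i) j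
  (subst T (trans (sym (Vec.[]=⇒lookup i∈)) (Vec.lookup∘tabulate _ i)) tt)

fibrePartition : (f : Fin n → ℕ) → FirstOccurrencesOrdered 0 f → Partition n
fibrePartition f o = record
  { blocks    = tabulate {n = height f} (fibre f ∘ toℕ)
  ; nonempty  = All.tabulate⁺ λ j →
      let (i , eq) = height-onto f o (toℕ j) (Fin.toℕ<n j) in i , ∈-fibre⁺ f eq
  ; disjoint  = AllPairs.tabulate⁺ λ j≢j′ (x , x∈) →
      let (x∈j , x∈j′) = x∈p∩q⁻ _ _ x∈
      in j≢j′ (Fin.toℕ-injective (trans (sym (∈-fibre⁻ f x∈j)) (∈-fibre⁻ f x∈j′)))
  ; cover     = λ x → Any.tabulate⁺ (fromℕ< (f<height f x))
      (∈-fibre⁺ f (sym (Fin.toℕ-fromℕ< (f<height f x))))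
  ; canonical = AllPairs.tabulate⁺-< λ {j} {j′} j<j′ x y (_ , x-min) (y∈ , _) →
      -- Every element `y` of block `j′` has an element of block `j` before it, and the minimum `x`
      -- is at most that one.
      let (i , i<y , eq) = o y (toℕ j) z≤n (subst (toℕ j <_) (sym (∈-fibre⁻ f y∈)) j<j′)
      in ℕ.≤-<-trans (x-min i (∈-fibre⁺ f eq)) i<y
  }

index-tabulate⁺ : ∀ {a p} {A : Set a} {P : A → Set p} (f : Fin k → A) (i : Fin k) (p : P (f i)) →
                  toℕ (index (Any.tabulate⁺ {P = P} {f = f} i p)) ≡ toℕ i
index-tabulate⁺ f zero    p = refl
index-tabulate⁺ f (suc i) p = cong suc (index-tabulate⁺ (f ∘ suc) i p)

word : Partition n → Fin n → ℕ
word π x = toℕ (index (cover π x))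

ρ-word : (π : Partition n) → ρ π ≡ map suc (tabulate (word π))
ρ-word π = sym (map-tabulate (word π) suc)

word-fibrePartition : (f : Fin n → ℕ) (o : FirstOccurrencesOrdered 0 f) →
                      ∀ i → word (fibrePartition f o) i ≡ f i
word-fibrePartition f o i = trans
  (index-tabulate⁺ {P = i ∈ₛ_} _ (fromℕ< (f<height f i)) _)
  (Fin.toℕ-fromℕ< (f<height f i))

module _ {a r} {A : Set a} {R : Rel A r} where

  lookup-AllPairs : ∀ {xs} → AllPairs R xs → ∀ {i j} → i Fin.< j →
                    R (List.lookup xs i) (List.lookup xs j)
  lookup-AllPairs (px ∷ _)  {zero}  {suc j} _   = All.lookup px (∈-lookup j)
  lookup-AllPairs (_ ∷ pxs) {suc i} {suc j} i<j = lookup-AllPairs pxs (s≤s⁻¹ i<j)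

same-block : ∀ {Bs : List (Subset n)} → AllPairs (λ B C → Empty (B ∩ C)) Bs →
             ∀ {x} i j → x ∈ₛ List.lookup Bs i → x ∈ₛ List.lookup Bs j → i ≡ j
same-block dis i j x∈i x∈j with Fin.<-cmp i j
... | tri≈ _ eq _  = eq
... | tri< i<j _ _ = contradiction (_ , x∈p∩q⁺ (x∈i , x∈j)) (lookup-AllPairs dis i<j)
... | tri> _ _ j<i = contradiction (_ , x∈p∩q⁺ (x∈j , x∈i)) (lookup-AllPairs dis j<i)

∃min : (B : Subset n) → Nonempty B → ∃[ x ] IsMin B x
∃min (true  ∷ B) _                    = zero , Vec.here , λ _ _ → z≤n
∃min (false ∷ B) (suc x , Vec.there x∈B) =
  let (y , y∈B , y-min) = ∃min B (x , x∈B)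
  in suc y , Vec.there y∈B , λ { (suc z) (Vec.there z∈B) → s≤s (y-min z z∈B) }

module _ (π : Partition n) where

  private
    block : Fin (length (blocks π)) → Subset n
    block = List.lookup (blocks π)

  block-index : ∀ {x} j → x ∈ₛ block j → word π x ≡ toℕ j
  block-index {x} j x∈j =
    cong toℕ (same-block (disjoint π) _ j (Any.lookup-index (cover π x)) x∈j)

  -- The witness for `j` is the minimum of block `j`: canonical order puts it before the minimum of
  -- the block of `x`, which is at most `x`.
  word-ordered : FirstOccurrencesOrdered 0 (word π)
  word-ordered x j _ j<c =
    let c : Fin (length (blocks π))
        c = index (cover π x)
        j<l = ℕ.<-trans j<c (Fin.toℕ<n c)
        b = fromℕ< j<l
        (y , y-min) = ∃min (block b) (All.lookup (nonempty π) (∈-lookup b))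
        (z , z-min) = ∃min (block c) (All.lookup (nonempty π) (∈-lookup c))
        b<c = subst (_< toℕ c) (sym (Fin.toℕ-fromℕ< j<l)) j<c
        y<z = lookup-AllPairs (canonical π) b<c y z y-min z-min
    in y , ℕ.<-≤-trans y<z (proj₂ z-min x (Any.lookup-index (cover π x)))
         , trans (block-index b (proj₁ y-min)) (Fin.toℕ-fromℕ< j<l)

  height-word : height (word π) ≡ length (blocks π)
  height-word = height≡ (word π) (λ x → Fin.toℕ<n (index (cover π x))) λ j j<l →
    let (x , x∈) = All.lookup (nonempty π) (∈-lookup (fromℕ< j<l))
    in x , trans (block-index _ x∈) (Fin.toℕ-fromℕ< j<l)

  fibre-word : ∀ j → fibre (word π) (toℕ j) ≡ block j
  fibre-word j = ⊆-antisym
    (λ {x} x∈ → subst (λ i → x ∈ₛ block i) (Fin.toℕ-injective (∈-fibre⁻ (word π) x∈))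
                  (Any.lookup-index (cover π x)))
    (λ x∈ → ∈-fibre⁺ (word π) (block-index j x∈))

  blocks-word : tabulate {n = height (word π)} (fibre (word π) ∘ toℕ) ≡ blocks π
  blocks-word rewrite height-word =
    trans (tabulate-cong fibre-word) (tabulate-lookup (blocks π))

height-cong : {f g : Fin n → ℕ} → (∀ i → f i ≡ g i) → height f ≡ height g
height-cong {zero}  f≗g = refl
height-cong {suc n} f≗g = cong₂ (λ x → suc x ⊔_) (f≗g zero) (height-cong (f≗g ∘ suc))

fibres-cong : {f g : Fin n → ℕ} → (∀ i → f i ≡ g i) →
              tabulate {n = height f} (fibre f ∘ toℕ) ≡ tabulate {n = height g} (fibre g ∘ toℕ)
fibres-cong {f = f} {g} f≗g rewrite height-cong f≗g =
  tabulate-cong λ j → Vec.tabulate-cong λ i → cong (λ x → does (x ℕ.≟ toℕ j)) (f≗g i)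

word-cong : (π σ : Partition n) → blocks π ≡ blocks σ → ∀ x → word π x ≡ word σ x
word-cong record { blocks = Bs ; disjoint = dis ; cover = c } record { cover = c′ } refl x =
  cong toℕ (same-block dis (index (c x)) (index (c′ x))
             (Any.lookup-index (c x)) (Any.lookup-index (c′ x)))

toList-lookup : ∀ {a} {A : Set a} (v : Vec A n) → toList v ≡ tabulate (Vec.lookup v)
toList-lookup []      = refl
toList-lookup (x ∷ v) = cong (x ∷_) (toList-lookup v)

lookup-Unique : ∀ {a} {A : Set a} {xs : List A} → Unique xs →
                ∀ i j → List.lookup xs i ≡ List.lookup xs j → i ≡ j
lookup-Unique u i j eq with Fin.<-cmp i j
... | tri≈ _ i≡j _ = i≡j
... | tri< i<j _ _ = contradiction eq (lookup-AllPairs u i<j)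
... | tri> _ _ j<i = contradiction (sym eq) (lookup-AllPairs u j<i)

module _ {m} (π : Partition m) (ws : List (Vec ℕ n)) (unique : Unique ws)
         (sound : ∀ {v} → v ∈ ws →
                  RGF 0 (toList v) × ¬ Contains (map suc (toList v)) (ρ π))
         (complete : ∀ v → RGF 0 (toList v) → ¬ Contains (map suc (toList v)) (ρ π) →
                     v ∈ ws) where

  private
    wordVec : Partition n → Vec ℕ n
    wordVec σ = Vec.tabulate (word σ)

    toList-wordVec : ∀ σ → toList (wordVec σ) ≡ tabulate (word σ)
    toList-wordVec σ =
      trans (toList-lookup (wordVec σ)) (tabulate-cong (Vec.lookup∘tabulate (word σ)))

    member : (σ : Partition n) → RAvoids σ π → wordVec σ ∈ ws
    member σ av = complete (wordVec σ)
      (subst (RGF 0) (sym (toList-wordVec σ)) (rgf⁺ (word σ) (word-ordered σ)))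
      (subst (λ w → ¬ Contains w (ρ π))
        (trans (ρ-word σ) (cong (map suc) (sym (toList-wordVec σ)))) av)

    ordered : ∀ i → FirstOccurrencesOrdered 0 (Vec.lookup (List.lookup ws i))
    ordered i = rgf⁻ _
      (subst (RGF 0) (toList-lookup (List.lookup ws i)) (proj₁ (sound (∈-lookup i))))

    partition : Fin (length ws) → Partition n
    partition i = fibrePartition (Vec.lookup (List.lookup ws i)) (ordered i)

    word-partition : ∀ i → wordVec (partition i) ≡ List.lookup ws i
    word-partition i = trans
      (Vec.tabulate-cong (word-fibrePartition _ (ordered i)))
      (Vec.tabulate∘lookup (List.lookup ws i))

    avoids : ∀ i → RAvoids (partition i) π
    avoids i = subst (λ w → ¬ Contains w (ρ π))
      (sym (trans (ρ-word (partition i))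
        (cong (map suc)
          (trans (sym (toList-wordVec (partition i))) (cong toList (word-partition i))))))
      (proj₂ (sound (∈-lookup i)))

    index-wordVec : ∀ σ σ′ (p : wordVec σ ∈ ws) (p′ : wordVec σ′ ∈ ws) →
                    blocks σ ≡ blocks σ′ → index p ≡ index p′
    index-wordVec σ σ′ p p′ eq = lookup-Unique unique _ _
      (trans (sym (Any.lookup-index p))
        (trans (Vec.tabulate-cong (word-cong σ σ′ eq)) (Any.lookup-index p′)))

  -- Position in the list `ws` is the bijection. Equality in `R n π` compares blocks only, so
  -- uniqueness of `ws` is needed to make the position independent of the membership proof.
  hasCardinality : HasCardinality (R n π) (length ws)
  hasCardinality = record
    { to        = λ (σ , av) → index (member σ av)
    ; from      = λ i → partition i , avoids i
    ; to-cong   = λ {(σ , av)} {(σ′ , av′)} → index-wordVec σ σ′ (member σ av) (member σ′ av′)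
    ; from-cong = λ { refl → refl }
    ; inverse   = (λ {i} {(σ , av)} eq → trans
                     (index-wordVec σ (partition i)
                       (member σ av) (member (partition i) (avoids i)) eq)
                     (to∘from i))
                , λ { {(σ , av)} refl → from∘to σ av }
    }
    where
    to∘from : ∀ i → index (member (partition i) (avoids i)) ≡ i
    to∘from i = lookup-Unique unique _ _
      (trans (sym (Any.lookup-index (member (partition i) (avoids i)))) (word-partition i))

    from∘to : ∀ σ av → blocks (partition (index (member σ av))) ≡ blocks σ
    from∘to σ av = trans
      (fibres-cong λ x → trans
        (cong (λ v → Vec.lookup v x) (sym (Any.lookup-index (member σ av))))
        (Vec.lookup∘tabulate (word σ) x))
      (blocks-word σ)

-- Automata

-- What the pattern arguments use of a restricted growth prefix with `k` letters: picking first
-- occurrences yields 0, ..., k-1 as a subsequence.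
Prefix : ℕ → List ℕ → Set
Prefix k p = All (_< k) p × upTo k ⊆ p

upTo-mono : ∀ {j k} → j ≤ k → upTo j ⊆ upTo k
upTo-mono {k = zero} z≤n = []
upTo-mono {j} {suc k} j≤1+k with ℕ.m≤n⇒m<n∨m≡n j≤1+k
... | inj₂ refl = ⊆-refl
... | inj₁ j<1+k = subst (upTo j ⊆_) (upTo-∷ʳ k) (++⁺ʳ [ k ] (upTo-mono (s≤s⁻¹ j<1+k)))

Prefix-∷ʳ : Prefix k p → x ≤ k → Prefix (k ⊔ suc x) (p ∷ʳ x)
Prefix-∷ʳ {k} {p} {x} (p<k , up) x≤k with ℕ.m≤n⇒m<n∨m≡n x≤k
... | inj₁ x<k rewrite ℕ.m≥n⇒m⊔n≡m x<k = All.∷ʳ⁺ p<k x<k , ++⁺ʳ [ x ] up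
... | inj₂ refl rewrite ℕ.m≤n⇒m⊔n≡n (ℕ.n≤1+n k) =
  All.∷ʳ⁺ (All.map ℕ.m<n⇒m<1+n p<k) ℕ.≤-refl ,
  subst (_⊆ p ∷ʳ k) (upTo-∷ʳ k) (++⁺ up ⊆-refl)

Prefix-++ : ∀ w → Prefix k p → RGF k w → ∃[ k′ ] Prefix k′ (p ++ w)
Prefix-++ {k} {p} []      pre _ = k , subst (Prefix k) (sym (++-identityʳ p)) pre
Prefix-++ {k} {p} (x ∷ w) pre (x≤k , r) =
  let (k′ , pre′) = Prefix-++ w (Prefix-∷ʳ pre x≤k) r
  in k′ , subst (Prefix k′) (∷ʳ-++ p x w) pre′

-- A deterministic automaton all of whose states are accepting.  The invariant
-- Inv s k p says which prefixes p, with k letters, lead to the state s.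
record Recogniser (Bad : List ℕ → Set) : Set₁ where
  field
    State    : Set
    δ        : State → List (ℕ × State)
    start    : State
    Inv      : State → ℕ → List ℕ → Set
    δ-unique : ∀ s → Unique (map proj₁ (δ s))
    start-ok : Inv start 0 []
    safe     : ∀ {s k p} → Prefix k p → Inv s k p → ¬ Bad p
    sound    : ∀ {s k p x s′} → Prefix k p → Inv s k p → (x , s′) ∈ δ s →
               x ≤ k × Inv s′ (k ⊔ suc x) (p ∷ʳ x)
    complete : ∀ {s k p x} → Prefix k p → Inv s k p → x ≤ k → ¬ Bad (p ∷ʳ x) →
               ∃[ s′ ] (x , s′) ∈ δ s

  words  : State → ∀ n → List (Vec ℕ n)
  branch : ∀ n → ℕ × State → List (Vec ℕ (suc n))
  words s zero    = [ [] ]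
  words s (suc n) = concatMap (branch n) (δ s)
  branch n (x , s′) = map (x ∷_) (words s′ n)

  count : State → ℕ → ℕ
  count s zero    = 1
  count s (suc n) = sum (map (λ (_ , s′) → count s′ n) (δ s))

  length-words : ∀ s n → length (words s n) ≡ count s n
  length-words s zero    = refl
  length-words s (suc n) = go (δ s)
    where
    go : ∀ ts → length (concatMap (branch n) ts) ≡
                sum (map (λ (_ , s′) → count s′ n) ts)
    go []              = refl
    go ((x , s′) ∷ ts) = trans (length-++ (map (x ∷_) (words s′ n)))
      (cong₂ _+_ (trans (length-map (x ∷_) (words s′ n)) (length-words s′ n)) (go ts))

  -- Different transitions out of a state carry different letters, so words from different branches
  -- already differ at the head.
  words-unique : ∀ s n → Unique (words s n)
  words-unique s zero    = [] ∷ []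
  words-unique s (suc n) = go (δ s) (δ-unique s)
    where
    go : ∀ ts → Unique (map proj₁ ts) →
         Unique (concatMap (branch n) ts)
    go []              _          = []
    go ((x , s′) ∷ ts) (x∉ ∷ u) =
      Unique.++⁺ (Unique.map⁺ Vec.∷-injectiveʳ (words-unique s′ n)) (go ts u) disjoint′
      where
      disjoint′ : ∀ {v} → ¬ (v ∈ branch n (x , s′) × v ∈ concatMap (branch n) ts)
      disjoint′ (v∈ , v∈′)
        with _ , _ , refl ← ∈-map⁻ _ v∈
        with i ← ∈-concatMap⁻ (branch n) {xs = ts} v∈′
        with x≢ , v∈″ ← All.lookupAny (All.map⁻ x∉) i
        with _ , _ , eq ← ∈-map⁻ _ v∈″
        = x≢ (Vec.∷-injectiveˡ eq)

  ∈-words⁻ : ∀ {s k p} n {v : Vec ℕ n} → Prefix k p → Inv s k p → v ∈ words s n →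
             RGF k (toList v) × ¬ Bad (p ++ toList v)
  ∈-words⁻ {p = p} zero {[]} pre inv _ =
    tt , subst (¬_ ∘ Bad) (sym (++-identityʳ p)) (safe pre inv)
  ∈-words⁻ {s} {p = p} (suc n) {x ∷ v} pre inv v∈
    with ((_ , s′) , t∈ , v∈′) ← find (∈-concatMap⁻ (branch n) {xs = δ s} v∈)
    with (_ , v∈″ , refl) ← ∈-map⁻ _ v∈′
    with (x≤k , inv′) ← sound pre inv t∈
    with (r , good) ← ∈-words⁻ n (Prefix-∷ʳ pre x≤k) inv′ v∈″
    = (x≤k , r) , subst (¬_ ∘ Bad) (∷ʳ-++ p x (toList v)) good

  -- Closure of `Bad` under extension hands the goodness of the whole word down to its prefixes,
  -- where `complete` asks for it.
  ∈-words⁺ : (∀ {p} w → Bad p → Bad (p ++ w)) →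
             ∀ {s k p n} (v : Vec ℕ n) → Prefix k p → Inv s k p →
             RGF k (toList v) → ¬ Bad (p ++ toList v) → v ∈ words s n
  ∈-words⁺ ext []      pre inv _ _ = here refl
  ∈-words⁺ ext {s} {p = p} {suc n} (x ∷ v) pre inv (x≤k , r) good =
    ∈-concatMap⁺ _ (Any.map (λ { refl → ∈-map⁺ (x ∷_) v∈ }) t∈)
    where
    good′ : ¬ Bad ((p ∷ʳ x) ++ toList v)
    good′ = good ∘ subst Bad (∷ʳ-++ p x (toList v))
    step = complete pre inv x≤k (good′ ∘ ext (toList v))
    t∈   = proj₂ step
    v∈   = ∈-words⁺ ext v (Prefix-∷ʳ pre x≤k) (proj₂ (sound pre inv t∈)) r good′

-- `contains⇒bad` is demanded on restricted growth words only, which lets `Bad` be simpler than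
-- containment: `1 ∷ 2 ∷ []` contains 12 without having `upTo 2` as a subsequence.
record Detects (r : List ℕ) (Bad : List ℕ → Set) : Set where
  field
    extend       : ∀ {p} w → Bad p → Bad (p ++ w)
    bad⇒contains : ∀ {w} → Bad w → Contains (map suc w) r
    contains⇒bad : ∀ {w} → Prefix k w → Contains (map suc w) r → Bad w

module _ {Bad : List ℕ → Set} (A : Recogniser Bad) where
  open Recogniser A

  #R≡count : ∀ {m} (π : Partition m) → Detects (ρ π) Bad →
             ∀ n → HasCardinality (R n π) (count start n)
  #R≡count π det n = subst (HasCardinality (R n π)) (length-words start n)
    (hasCardinality π (words start n) (words-unique start n)
      (λ v∈ → let (r , good) = ∈-words⁻ n ([] , []) start-ok v∈
              in r , good ∘ contains⇒bad (proj₂ (Prefix-++ _ ([] , []) r)))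
      (λ v r good → ∈-words⁺ extend v ([] , []) start-ok r (good ∘ bad⇒contains)))
    where open Detects det

-- Standardization and containment

count≤ : ℕ → List ℕ → ℕ
count≤ v xs = length (filter (ℕ._≤? v) xs)

-- Unfolds to the same term as the function local to `standardize`, so facts proved here apply
-- there.
rank : List ℕ → ℕ → ℕ
rank s v = count≤ v (deduplicate ℕ._≟_ s)

module _ {a p q} {A : Set a} {P : U.Pred A p} {Q : U.Pred A q}
         (P? : U.Decidable P) (Q? : U.Decidable Q) (P⊆Q : P U.⊆ Q) where

  length-filter-mono : ∀ xs → length (filter P? xs) ≤ length (filter Q? xs)
  length-filter-mono xs = length-mono-≤ (filter⁺ P? Q? (λ { refl → P⊆Q }) (⊆-refl {x = xs}))

  length-filter-strict : ∀ {v xs} → ¬ P v → Q v → v ∈ xs →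
                         length (filter P? xs) < length (filter Q? xs)
  length-filter-strict {v} {x ∷ xs} ¬Pv Qv v∈ with P? x | Q? x | v∈
  ... | yes Pv | _      | here refl = contradiction Pv ¬Pv
  ... | no _   | yes _  | here refl = s≤s (length-filter-mono xs)
  ... | no _   | no ¬Qv | here refl = contradiction Qv ¬Qv
  ... | yes _  | yes _  | there v∈′ = s≤s (length-filter-strict ¬Pv Qv v∈′)
  ... | yes Px | no ¬Qx | there _   = contradiction (P⊆Q Px) ¬Qx
  ... | no _   | yes _  | there v∈′ = ℕ.m≤n⇒m≤1+n (length-filter-strict ¬Pv Qv v∈′)
  ... | no _   | no _   | there v∈′ = length-filter-strict ¬Pv Qv v∈′

count≤-mono : ∀ xs → u ≤ v → count≤ u xs ≤ count≤ v xs
count≤-mono {u} {v} xs u≤v =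
  length-filter-mono (ℕ._≤? u) (ℕ._≤? v) (λ x≤u → ℕ.≤-trans x≤u u≤v) xs

count≤-strict : ∀ {xs} → u < v → v ∈ xs → count≤ u xs < count≤ v xs
count≤-strict {u} {v} u<v = length-filter-strict (ℕ._≤? u) (ℕ._≤? v)
  (λ x≤u → ℕ.≤-trans x≤u (ℕ.<⇒≤ u<v)) (ℕ.<⇒≱ u<v) ℕ.≤-refl

rank-cancel-< : ∀ s → rank s u < rank s v → u < v
rank-cancel-< s r<r = ℕ.≰⇒> λ v≤u → ℕ.<⇒≱ r<r (count≤-mono (deduplicate ℕ._≟_ s) v≤u)

rank-injective : u ∈ s → v ∈ s → rank s u ≡ rank s v → u ≡ v
rank-injective {u} {s} {v} u∈ v∈ eq with ℕ.<-cmp u v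
... | tri≈ _ u≡v _ = u≡v
... | tri< u<v _ _ = contradiction eq (ℕ.<⇒≢ (count≤-strict u<v (∈-deduplicate⁺ ℕ._≟_ v∈)))
... | tri> _ _ v<u = contradiction (sym eq) (ℕ.<⇒≢ (count≤-strict v<u (∈-deduplicate⁺ ℕ._≟_ u∈)))

filter-map : ∀ {a p q} {A B : Set a} {P : U.Pred B p} {Q : U.Pred A q}
             (P? : U.Decidable P) (Q? : U.Decidable Q) (f : A → B) →
             (∀ {x} → P (f x) → Q x) → (∀ {x} → Q x → P (f x)) →
             ∀ xs → filter P? (map f xs) ≡ map f (filter Q? xs)
filter-map P? Q? f P⇒Q Q⇒P [] = refl
filter-map P? Q? f P⇒Q Q⇒P (x ∷ xs) with P? (f x) | Q? x
... | yes _ | yes _ = cong (f x ∷_) (filter-map P? Q? f P⇒Q Q⇒P xs)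
... | yes p | no ¬q = contradiction (P⇒Q p) ¬q
... | no ¬p | yes q = contradiction (Q⇒P q) ¬p
... | no _  | no _  = filter-map P? Q? f P⇒Q Q⇒P xs

StrictlyMonotone : (ℕ → ℕ) → Set
StrictlyMonotone f = f Preserves _<_ ⟶ _<_

module _ {f : ℕ → ℕ} (mono : StrictlyMonotone f) where

  cancel-≤ : f u ≤ f v → u ≤ v
  cancel-≤ fu≤fv = ℕ.≮⇒≥ λ v<u → ℕ.<⇒≱ (mono v<u) fu≤fv

  mono-≤ : u ≤ v → f u ≤ f v
  mono-≤ u≤v with ℕ.m≤n⇒m<n∨m≡n u≤v
  ... | inj₁ u<v  = ℕ.<⇒≤ (mono u<v)
  ... | inj₂ refl = ℕ.≤-refl

  injective : f u ≡ f v → u ≡ v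
  injective eq = ℕ.≤-antisym (cancel-≤ (ℕ.≤-reflexive eq)) (cancel-≤ (ℕ.≤-reflexive (sym eq)))

  deduplicate-map : ∀ xs → deduplicate ℕ._≟_ (map f xs) ≡ map f (deduplicate ℕ._≟_ xs)
  deduplicate-map []       = refl
  deduplicate-map (x ∷ xs) = cong (f x ∷_) (trans
    (cong (filter (¬? ∘ (f x ℕ.≟_))) (deduplicate-map xs))
    (filter-map (¬? ∘ (f x ℕ.≟_)) (¬? ∘ (x ℕ.≟_)) f
      (λ ≢ eq → ≢ (cong f eq)) (λ ≢ eq → ≢ (injective eq)) (deduplicate ℕ._≟_ xs)))

  rank-map : ∀ s v → rank (map f s) (f v) ≡ rank s v
  rank-map s v = begin
    count≤ (f v) (deduplicate ℕ._≟_ (map f s))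
      ≡⟨ cong (count≤ (f v)) (deduplicate-map s) ⟩
    count≤ (f v) (map f (deduplicate ℕ._≟_ s))
      ≡⟨ cong length (filter-map (ℕ._≤? f v) (ℕ._≤? v) f cancel-≤ mono-≤ (deduplicate ℕ._≟_ s)) ⟩
    length (map f (filter (ℕ._≤? v) (deduplicate ℕ._≟_ s)))
      ≡⟨ length-map f (filter (ℕ._≤? v) (deduplicate ℕ._≟_ s)) ⟩
    rank s v ∎
    where open ≡-Reasoning

  standardize-map : ∀ s → standardize (map f s) ≡ standardize s
  standardize-map s = trans (sym (map-∘ s)) (map-cong (rank-map s) s)

contains⁺ : {f : ℕ → ℕ} → StrictlyMonotone f → map f s ⊆ w → Contains (map suc w) (standardize s)
contains⁺ {s} {f = f} mono sub =
  map suc (map f s) , map⁺ suc sub , trans (standardize-map s≤s (map f s)) (standardize-map mono s)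

contains⁻ : ∀ {r} → Contains (map suc w) r → ∃[ s ] (s ⊆ w × standardize s ≡ r)
contains⁻ {w} (s′ , sub , eq) with unmap w sub
  where
  unmap : ∀ w {s′} → s′ ⊆ map suc w → ∃[ s ] (s′ ≡ map suc s × s ⊆ w)
  unmap []      []                = [] , refl , []
  unmap (x ∷ w) (_ Sublist.∷ʳ sub) =
    let (s , eq , sub′) = unmap w sub in s , eq , x Sublist.∷ʳ sub′
  unmap (x ∷ w) (refl ∷ sub)       =
    let (s , eq , sub′) = unmap w sub in x ∷ s , cong (suc x ∷_) eq , refl ∷ sub′
... | s , refl , sub′ = s , sub′ , trans (sym (standardize-map s≤s s)) eq

-- Places the two letters of a pattern at `a` and `b`. The values past 1 continue it so that the map
-- is strictly increasing on all of ℕ whenever `a < b`, as `standardize-map` requires.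
spread : ℕ → ℕ → ℕ → ℕ
spread a b zero    = a
spread a b (suc x) = x + b

spread-mono : ∀ {a b} → a < b → StrictlyMonotone (spread a b)
spread-mono         a<b {zero}  {suc y} _   = ℕ.≤-trans a<b (ℕ.m≤n+m _ y)
spread-mono {b = b} a<b {suc x} {suc y} x<y = ℕ.+-monoˡ-< b (s≤s⁻¹ x<y)

snoc⁻ : ∀ s p → s ∷ʳ y ⊆ p ∷ʳ x → s ∷ʳ y ⊆ p ⊎ (s ⊆ p × y ≡ x)
snoc⁻ []          []      (refl ∷ _)         = inj₂ ([] , refl)
snoc⁻ []          []      (_ Sublist.∷ʳ ())
snoc⁻ (_ ∷ [])    []      (refl ∷ ())
snoc⁻ (_ ∷ _ ∷ _) []      (refl ∷ ())
snoc⁻ (_ ∷ _)     []      (_ Sublist.∷ʳ ())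
snoc⁻ []          (z ∷ p) (refl ∷ _)         = inj₁ (refl ∷ minimum p)
snoc⁻ (_ ∷ s)     (z ∷ p) (refl ∷ sub) with snoc⁻ s p sub
... | inj₁ sub′         = inj₁ (refl ∷ sub′)
... | inj₂ (sub′ , y≡x) = inj₂ (refl ∷ sub′ , y≡x)
snoc⁻ s           (z ∷ p) (_ Sublist.∷ʳ sub) with snoc⁻ s p sub
... | inj₁ sub′         = inj₁ (z Sublist.∷ʳ sub′)
... | inj₂ (sub′ , y≡x) = inj₂ (z Sublist.∷ʳ sub′ , y≡x)

snoc⁺ : s ⊆ p → s ∷ʳ x ⊆ p ∷ʳ x
snoc⁺ sub = ++⁺ sub ⊆-refl

prefix-∋ : Prefix k p → x < k → [ x ] ⊆ p
prefix-∋ (_ , up) x<k = ⊆-trans (from∈ (∈-upTo⁺ x<k)) up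

prefix-pair : Prefix k p → ∀ {x y} → x < y → y < k → x ∷ y ∷ [] ⊆ p
prefix-pair {k} (_ , up) {x} {y} x<y y<k =
  ⊆-trans (snoc⁺ (from∈ (∈-upTo⁺ x<y)))
    (subst (_⊆ _) (sym (upTo-∷ʳ y)) (⊆-trans (upTo-mono y<k) up))

prefix-bound : Prefix k p → x ∷ s ⊆ p → x < k
prefix-bound (p<k , _) sub = All.head (All-resp-⊆ sub p<k)

-- The patterns of length three

Occurs : List ℕ → List ℕ → Set
Occurs t w = ∃[ a ] ∃[ b ] (a < b × map (spread a b) t ⊆ w)

-- These patterns have two distinct letters, so a subsequence with the right standardization is
-- determined by two values `a < b`, which `classify` recovers.
occurs-detects : ∀ t → (∀ s → standardize s ≡ standardize t →
                        ∃[ a ] ∃[ b ] (a < b × s ≡ map (spread a b) t)) →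
                 Detects (standardize t) (Occurs t)
occurs-detects t classify = record
  { extend       = λ w (a , b , a<b , sub) → a , b , a<b , ++⁺ʳ w sub
  ; bad⇒contains = λ (a , b , a<b , sub) → contains⁺ {s = t} (spread-mono a<b) sub
  ; contains⇒bad = λ _ c → let (s , sub , eq) = contains⁻ c
                               (a , b , a<b , s≡) = classify s eq
                           in a , b , a<b , subst (_⊆ _) s≡ sub
  }

-- Reduces the check of a transition to the occurrences that end in the letter just read.
occurs-∷ʳ⁻ : ∀ t l → Occurs (t ∷ʳ l) (p ∷ʳ x) →
             Occurs (t ∷ʳ l) p ⊎
             ∃[ a ] ∃[ b ] (a < b × map (spread a b) t ⊆ p × spread a b l ≡ x)
occurs-∷ʳ⁻ {p} {x} t l (a , b , a<b , sub)
  with snoc⁻ (map (spread a b) t) p (subst (_⊆ p ∷ʳ x) (map-++ (spread a b) t [ l ]) sub)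
... | inj₁ sub′        = inj₁ (a , b , a<b , subst (_⊆ p) (sym (map-++ (spread a b) t [ l ])) sub′)
... | inj₂ (sub′ , eq) = inj₂ (a , b , a<b , sub′ , eq)

-- Equal ranks mean equal letters and a smaller rank a smaller letter, so the relations that
-- `classify` needs can be read off the standardization.
module _ a b c {x y z} (eq : standardize (a ∷ b ∷ c ∷ []) ≡ x ∷ y ∷ z ∷ []) where

  private
    abc : List ℕ
    abc = a ∷ b ∷ c ∷ []

    ranks : rank abc a ≡ x × rank abc b ≡ y × rank abc c ≡ z
    ranks = let (p , eq′) = ∷-injective eq ; (q , eq″) = ∷-injective eq′
            in p , q , ∷-injectiveˡ eq″

  first≡second : x ≡ y → a ≡ b
  first≡second x≡y = let (p , q , _) = ranks in
    rank-injective {s = abc} (here refl) (there (here refl)) (trans p (trans x≡y (sym q)))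

  first≡third : x ≡ z → a ≡ c
  first≡third x≡z = let (p , _ , q) = ranks in
    rank-injective {s = abc} (here refl) (there (there (here refl))) (trans p (trans x≡z (sym q)))

  second≡third : y ≡ z → b ≡ c
  second≡third y≡z = let (_ , p , q) = ranks in
    rank-injective {s = abc} (there (here refl)) (there (there (here refl)))
      (trans p (trans y≡z (sym q)))

  first<second : x < y → a < b
  first<second x<y = let (p , q , _) = ranks in
    rank-cancel-< abc (subst (_ <_) (sym q) (subst (_< y) (sym p) x<y))

  first<third : x < z → a < c
  first<third x<z = let (p , _ , q) = ranks in
    rank-cancel-< abc (subst (_ <_) (sym q) (subst (_< z) (sym p) x<z))

detects-112 : Detects (1 ∷ 1 ∷ 2 ∷ []) (Occurs (0 ∷ 0 ∷ 1 ∷ []))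
detects-112 = occurs-detects (0 ∷ 0 ∷ 1 ∷ []) λ where
  (a ∷ b ∷ c ∷ []) eq → a , c , first<third a b c eq (s≤s (s≤s z≤n)) ,
    cong (λ y → a ∷ y ∷ c ∷ []) (sym (first≡second a b c eq refl))

detects-121 : Detects (1 ∷ 2 ∷ 1 ∷ []) (Occurs (0 ∷ 1 ∷ 0 ∷ []))
detects-121 = occurs-detects (0 ∷ 1 ∷ 0 ∷ []) λ where
  (a ∷ b ∷ c ∷ []) eq → a , b , first<second a b c eq (s≤s (s≤s z≤n)) ,
    cong (λ z → a ∷ b ∷ z ∷ []) (sym (first≡third a b c eq refl))

detects-122 : Detects (1 ∷ 2 ∷ 2 ∷ []) (Occurs (0 ∷ 1 ∷ 1 ∷ []))
detects-122 = occurs-detects (0 ∷ 1 ∷ 1 ∷ []) λ where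
  (a ∷ b ∷ c ∷ []) eq → a , b , first<second a b c eq (s≤s (s≤s z≤n)) ,
    cong (λ z → a ∷ b ∷ z ∷ []) (sym (second≡third a b c eq refl))

-- Patterns for which each prefix leaves exactly one of the letters already
-- used available.
record OneOldLetter (Bad : List ℕ → Set) : Set where
  field
    old     : ℕ → ℕ
    old≤    : ∀ j → old j ≤ j
    bad-[]  : ¬ Bad []
    bad-old : ∀ {j p} → Prefix (suc j) p → Bad (p ∷ʳ old j) → Bad p
    bad-new : ∀ {k p} → Prefix k p → Bad (p ∷ʳ k) → Bad p
    bad     : ∀ {j p x} → Prefix (suc j) p → x ≤ j → x ≢ old j → Bad (p ∷ʳ x)

  δ : ℕ → List (ℕ × ℕ)
  δ zero    = [ 0 , 1 ]
  δ (suc j) = (old j , suc j) ∷ (suc j , suc (suc j)) ∷ []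

  recogniser : Recogniser Bad
  recogniser = record
    { State    = ℕ
    ; δ        = δ
    ; start    = 0
    ; Inv      = λ j k p → j ≡ k × ¬ Bad p
    ; δ-unique = λ where
        zero    → [] ∷ []
        (suc j) → (ℕ.<⇒≢ (s≤s (old≤ j)) ∷ []) ∷ [] ∷ []
    ; start-ok = refl , bad-[]
    ; safe     = λ _ → proj₂
    ; sound    = sound
    ; complete = complete
    }
    where
    sound : ∀ {j k p x s′} → Prefix k p → j ≡ k × ¬ Bad p → (x , s′) ∈ δ j →
            x ≤ k × (s′ ≡ k ⊔ suc x) × ¬ Bad (p ∷ʳ x)
    sound {zero}  pre (refl , good) (here refl) = z≤n , refl , good ∘ bad-new pre
    sound {suc j} pre (refl , good) (here refl) =
      ℕ.m≤n⇒m≤1+n (old≤ j) , sym (ℕ.m≥n⇒m⊔n≡m (s≤s (old≤ j))) , good ∘ bad-old pre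
    sound {suc j} pre (refl , good) (there (here refl)) =
      ℕ.≤-refl , sym (ℕ.m≤n⇒m⊔n≡n (ℕ.n≤1+n (suc j))) , good ∘ bad-new pre

    complete : ∀ {j k p x} → Prefix k p → j ≡ k × ¬ Bad p → x ≤ k → ¬ Bad (p ∷ʳ x) →
               ∃[ s′ ] (x , s′) ∈ δ j
    complete {zero}          pre (refl , _) z≤n  _ = 1 , here refl
    complete {suc j} {x = x} pre (refl , _) x≤1+j good with ℕ.m≤n⇒m<n∨m≡n x≤1+j
    ... | inj₂ refl = suc (suc j) , there (here refl)
    ... | inj₁ x<1+j with x ℕ.≟ old j
    ...   | yes refl = suc j , here refl
    ...   | no x≢    = contradiction (bad pre (s≤s⁻¹ x<1+j) x≢) good

-- An old letter x below the largest letter j completes x j x. The letter j itself completes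
-- nothing, as no larger letter has been read.
oneOldLetter-121 : OneOldLetter (Occurs (0 ∷ 1 ∷ 0 ∷ []))
oneOldLetter-121 = record
  { old     = id
  ; old≤    = λ _ → ℕ.≤-refl
  ; bad-[]  = λ { (_ , _ , _ , ()) }
  ; bad-old = λ pre o → [ id , (λ { (a , b , a<b , sub , refl) →
      contradiction a<b (ℕ.<⇒≱ (prefix-bound pre (∷ˡ⁻ sub))) }) ]′ (occurs-∷ʳ⁻ (0 ∷ 1 ∷ []) 0 o)
  ; bad-new = λ pre o → [ id , (λ { (a , b , a<b , sub , refl) →
      contradiction (prefix-bound pre sub) (ℕ.<-irrefl refl) }) ]′ (occurs-∷ʳ⁻ (0 ∷ 1 ∷ []) 0 o)
  ; bad     = λ pre x≤j x≢j → let x<j = ℕ.≤∧≢⇒< x≤j x≢j in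
      _ , _ , x<j , snoc⁺ (prefix-pair pre x<j ℕ.≤-refl)
  }

-- An old letter x above 0 completes 0 x x, while 0 has no smaller letter to play the part of the 1.
oneOldLetter-122 : OneOldLetter (Occurs (0 ∷ 1 ∷ 1 ∷ []))
oneOldLetter-122 = record
  { old     = λ _ → 0
  ; old≤    = λ _ → z≤n
  ; bad-[]  = λ { (_ , _ , _ , ()) }
  ; bad-old = λ pre o → [ id , (λ { (a , b , a<b , sub , refl) → contradiction a<b ℕ.n≮0 }) ]′
      (occurs-∷ʳ⁻ (0 ∷ 1 ∷ []) 1 o)
  ; bad-new = λ pre o → [ id , (λ { (a , b , a<b , sub , refl) →
      contradiction (prefix-bound pre (∷ˡ⁻ sub)) (ℕ.<-irrefl refl) }) ]′
      (occurs-∷ʳ⁻ (0 ∷ 1 ∷ []) 1 o)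
  ; bad     = λ pre x≤j x≢0 → let 0<x = ℕ.n≢0⇒n>0 x≢0 in
      _ , _ , 0<x , snoc⁺ (prefix-pair pre 0<x (s≤s x≤j))
  }

-- Words avoiding 112 increase strictly up to the first repeated letter and
-- decrease weakly from there on.
data State112 : Set where
  increasing : ℕ → State112
  decreasing : ℕ → State112

decrease : ℕ → ℕ × State112
decrease v = v , decreasing v

δ112 : State112 → List (ℕ × State112)
δ112 (increasing k) = (k , increasing (suc k)) ∷ map decrease (upTo k)
δ112 (decreasing v) = map decrease (upTo (suc v))

-- In a decreasing state, `v` is the least repeated letter. A next letter above `v` completes 112; a
-- letter `u ≤ v` is already present, so reading it makes `u` the least repeated letter.
Inv112 : State112 → ℕ → List ℕ → Set
Inv112 (increasing j) k p = j ≡ k × (∀ a → ¬ (a ∷ a ∷ [] ⊆ p))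
Inv112 (decreasing v) k p =
  v < k × v ∷ v ∷ [] ⊆ p × (∀ a → a ∷ a ∷ [] ⊆ p → v ≤ a) × ¬ Occurs (0 ∷ 0 ∷ 1 ∷ []) p

recogniser-112 : Recogniser (Occurs (0 ∷ 0 ∷ 1 ∷ []))
recogniser-112 = record
  { State    = State112
  ; δ        = δ112
  ; start    = increasing 0
  ; Inv      = Inv112
  ; δ-unique = δ-unique
  ; start-ok = refl , λ _ ()
  ; safe     = safe
  ; sound    = sound
  ; complete = complete
  }
  where
  Bad = Occurs (0 ∷ 0 ∷ 1 ∷ [])

  letters : ∀ k → map proj₁ (map decrease (upTo k)) ≡ upTo k
  letters k = trans (sym (map-∘ (upTo k))) (map-id (upTo k))

  δ-unique : ∀ s → Unique (map proj₁ (δ112 s))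
  δ-unique (increasing k) rewrite letters k =
    All.map (λ x<k k≡x → ℕ.<-irrefl (sym k≡x) x<k) (All.tabulate ∈-upTo⁻) ∷ Unique.upTo⁺ k
  δ-unique (decreasing v) rewrite letters (suc v) = Unique.upTo⁺ (suc v)

  safe : ∀ {s k p} → Prefix k p → Inv112 s k p → ¬ Bad p
  safe {increasing j} _ (_ , distinct) (a , b , _ , sub) =
    distinct a (⊆-trans (++⁺ʳ [ b ] ⊆-refl) sub)
  safe {decreasing v} _ (_ , _ , _ , good) = good

  repeat⁻ : ∀ {a p} → a ∷ a ∷ [] ⊆ p ∷ʳ x → a ∷ a ∷ [] ⊆ p ⊎ ([ a ] ⊆ p × a ≡ x)
  repeat⁻ = snoc⁻ [ _ ] _

  sound : ∀ {s k p x s′} → Prefix k p → Inv112 s k p → (x , s′) ∈ δ112 s →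
          x ≤ k × Inv112 s′ (k ⊔ suc x) (p ∷ʳ x)
  sound {increasing k} pre (refl , distinct) (here refl) =
    ℕ.≤-refl , sym (ℕ.m≤n⇒m⊔n≡n (ℕ.n≤1+n k)) , λ a sub → [ distinct a ,
      (λ { (sub′ , refl) → ℕ.<-irrefl refl (prefix-bound pre sub′) }) ]′ (repeat⁻ sub)
  sound {increasing k} pre inv@(refl , distinct) (there t∈)
    with v , v∈ , refl ← ∈-map⁻ decrease t∈ =
    ℕ.<⇒≤ (∈-upTo⁻ v∈) , ℕ.m≤n⊔m k (suc v) , snoc⁺ (prefix-∋ pre (∈-upTo⁻ v∈)) ,
    (λ a sub → [ (λ sub′ → contradiction sub′ (distinct a)) ,
                 (λ (_ , a≡v) → ℕ.≤-reflexive (sym a≡v)) ]′ (repeat⁻ sub)) ,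
    λ o → [ safe {increasing k} pre inv ,
            (λ (a , _ , _ , sub , _) → distinct a sub) ]′ (occurs-∷ʳ⁻ (0 ∷ 0 ∷ []) 1 o)
  sound {decreasing v} {k} pre (v<k , vv , least , good) t∈
    with u , u∈ , refl ← ∈-map⁻ decrease t∈ =
    let u≤v = s≤s⁻¹ (∈-upTo⁻ u∈) ; u<k = ℕ.≤-<-trans u≤v v<k in
    ℕ.<⇒≤ u<k , ℕ.m≤n⊔m k (suc u) , snoc⁺ (prefix-∋ pre u<k) ,
    (λ a sub → [ (λ sub′ → ℕ.≤-trans u≤v (least a sub′)) ,
                 (λ (_ , a≡u) → ℕ.≤-reflexive (sym a≡u)) ]′ (repeat⁻ sub)) ,
    λ o → [ good , (λ { (a , b , a<b , sub , refl) →
              ℕ.<⇒≱ (ℕ.<-≤-trans a<b u≤v) (least a sub) }) ]′ (occurs-∷ʳ⁻ (0 ∷ 0 ∷ []) 1 o)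

  complete : ∀ {s k p x} → Prefix k p → Inv112 s k p → x ≤ k → ¬ Bad (p ∷ʳ x) →
             ∃[ s′ ] (x , s′) ∈ δ112 s
  complete {increasing k} _ (refl , _) x≤k _ with ℕ.m≤n⇒m<n∨m≡n x≤k
  ... | inj₂ refl = _ , here refl
  ... | inj₁ x<k  = _ , there (∈-map⁺ decrease (∈-upTo⁺ x<k))
  complete {decreasing v} {x = x} _ (_ , vv , _) _ good =
    _ , ∈-map⁺ decrease (∈-upTo⁺ (s≤s (ℕ.≮⇒≥ λ v<x → good (v , x , v<x , snoc⁺ vv))))

-- The patterns 1/2/…/m and 12…m

deduplicate-unique : ∀ {xs} → Unique xs → deduplicate ℕ._≟_ xs ≡ xs
deduplicate-unique []                  = refl
deduplicate-unique {x ∷ xs} (x∉ ∷ u) rewrite deduplicate-unique u =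
  cong (x ∷_) (filter-all (¬? ∘ (x ℕ.≟_)) x∉)

count≤-upTo : ∀ v m → v < m → count≤ v (upTo m) ≡ suc v
count≤-upTo v (suc m) v<1+m with ℕ.m≤n⇒m<n∨m≡n (s≤s⁻¹ v<1+m)
... | inj₂ refl = trans
  (cong length (filter-all (ℕ._≤? v) (All.tabulate (s≤s⁻¹ ∘ ∈-upTo⁻))))
  (length-upTo (suc v))
... | inj₁ v<m  = begin
  count≤ v (upTo (suc m))      ≡⟨ cong (count≤ v) (upTo-∷ʳ m) ⟨
  count≤ v (upTo m ∷ʳ m)       ≡⟨ cong length (filter-++ (ℕ._≤? v) (upTo m) [ m ]) ⟩
  length (filter (ℕ._≤? v) (upTo m) ++ filter (ℕ._≤? v) [ m ])
    ≡⟨ cong (λ l → length (filter (ℕ._≤? v) (upTo m) ++ l))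
            (filter-reject (ℕ._≤? v) (ℕ.<⇒≱ v<m)) ⟩
  length (filter (ℕ._≤? v) (upTo m) ++ [])
    ≡⟨ cong length (++-identityʳ (filter (ℕ._≤? v) (upTo m))) ⟩
  count≤ v (upTo m)            ≡⟨ count≤-upTo v m v<m ⟩
  suc v                        ∎
  where open ≡-Reasoning

standardize-upTo : ∀ m → standardize (upTo m) ≡ map suc (upTo m)
standardize-upTo m = map-cong-local (All.tabulate λ {v} v∈ →
  trans (cong (count≤ v) (deduplicate-unique (Unique.upTo⁺ m))) (count≤-upTo v m (∈-upTo⁻ v∈)))

increasing-length : ∀ {c s} → AllPairs _<_ s → All (c ≤_) s → All (_< k) s → c ≤ k →
                    c + length s ≤ k
increasing-length {c = c} []  _ _ c≤k = subst (_≤ _) (sym (ℕ.+-identityʳ c)) c≤k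
increasing-length {k} {c} {x ∷ s} (x<s ∷ inc) (c≤x ∷ _) (x<k ∷ s<k) _ = begin
  c + suc (length s) ≡⟨ ℕ.+-suc c (length s) ⟩
  suc c + length s   ≤⟨ ℕ.+-monoˡ-≤ (length s) (s≤s c≤x) ⟩
  suc x + length s   ≤⟨ increasing-length inc x<s s<k x<k ⟩
  k                  ∎
  where open ℕ.≤-Reasoning

-- An increasing subsequence of length m in a word with k letters forces m ≤ k, and then the first
-- occurrences of 0, ..., m-1 form one as well.
detects-increasing : ∀ m → Detects (map suc (upTo m)) (upTo m ⊆_)
detects-increasing m = record
  { extend       = λ w → ++⁺ʳ w
  ; bad⇒contains = λ {w} sub → subst (Contains (map suc w)) (standardize-upTo m)
      (contains⁺ {s = upTo m} id (subst (_⊆ w) (sym (map-id (upTo m))) sub))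
  ; contains⇒bad = contains⇒bad
  }
  where
  contains⇒bad : ∀ {k w} → Prefix k w → Contains (map suc w) (map suc (upTo m)) → upTo m ⊆ w
  contains⇒bad {k} (w<k , up) c with s , sub , eq ← contains⁻ c = ⊆-trans (upTo-mono m≤k) up
    where
    ranks-increasing : AllPairs _<_ (map (rank s) s)
    ranks-increasing = subst (AllPairs _<_) (sym eq)
      (AllPairs.map⁺ (AllPairs.map s≤s (AllPairs.applyUpTo⁺₁ id m (λ i<j _ → i<j))))

    length-s : length s ≡ m
    length-s = begin
      length s                  ≡⟨ length-map (rank s) s ⟨
      length (map (rank s) s)   ≡⟨ cong length eq ⟩
      length (map suc (upTo m)) ≡⟨ length-map suc (upTo m) ⟩
      length (upTo m)           ≡⟨ length-upTo m ⟩
      m                         ∎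
      where open ≡-Reasoning

    m≤k : m ≤ k
    m≤k = subst (_≤ k) length-s (increasing-length
      (AllPairs.map (rank-cancel-< s) (AllPairs.map⁻ ranks-increasing))
      (All.universal (λ _ → z≤n) s) (All-resp-⊆ sub w<k) z≤n)

stay : ℕ → ℕ → ℕ → ℕ × (ℕ × ℕ)
stay r k x = x , r , k

-- In state (r , k) there are k blocks so far, and at most r more may be opened.
δ-increasing : ℕ × ℕ → List (ℕ × (ℕ × ℕ))
δ-increasing (zero  , k) = map (stay zero k) (upTo k)
δ-increasing (suc r , k) = (k , r , suc k) ∷ map (stay (suc r) k) (upTo k)

recogniser-increasing : ∀ M → Recogniser (upTo (suc M) ⊆_)
recogniser-increasing M = record
  { State    = ℕ × ℕ
  ; δ        = δ-increasing
  ; start    = M , 0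
  ; Inv      = Inv
  ; δ-unique = δ-unique
  ; start-ok = refl , ℕ.+-identityʳ M
  ; safe     = λ {(r , _)} → safe {r}
  ; sound    = sound
  ; complete = complete
  }
  where
  Inv : ℕ × ℕ → ℕ → List ℕ → Set
  Inv (r , j) k p = j ≡ k × r + k ≡ M

  letters : ∀ r k → map proj₁ (map (stay r k) (upTo k)) ≡ upTo k
  letters r k = trans (sym (map-∘ (upTo k))) (map-id (upTo k))

  δ-unique : ∀ s → Unique (map proj₁ (δ-increasing s))
  δ-unique (zero  , k) rewrite letters zero k = Unique.upTo⁺ k
  δ-unique (suc r , k) rewrite letters (suc r) k =
    All.tabulate (λ x∈ k≡x → ℕ.<-irrefl (sym k≡x) (∈-upTo⁻ x∈)) ∷ Unique.upTo⁺ k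

  safe : ∀ {r j k p} → Prefix k p → Inv (r , j) k p → ¬ (upTo (suc M) ⊆ p)
  safe {r} (p<k , _) (_ , refl) sub =
    -- `sub` would put the letter `M` below `k`, against `r + k ≡ M`.
    ℕ.<⇒≱ (All.lookup (All-resp-⊆ sub p<k) (∈-upTo⁺ ℕ.≤-refl)) (ℕ.m≤n+m _ r)

  sound-stay : ∀ {r k p x s′} → r + k ≡ M → (x , s′) ∈ map (stay r k) (upTo k) →
               x ≤ k × Inv s′ (k ⊔ suc x) p
  sound-stay {r} {k} eq t∈ with x , x∈ , refl ← ∈-map⁻ (stay r k) t∈
    rewrite ℕ.m≥n⇒m⊔n≡m (∈-upTo⁻ x∈) = ℕ.<⇒≤ (∈-upTo⁻ x∈) , refl , eq

  sound : ∀ {s k p x s′} → Prefix k p → Inv s k p → (x , s′) ∈ δ-increasing s →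
          x ≤ k × Inv s′ (k ⊔ suc x) (p ∷ʳ x)
  sound {zero  , k} {p = p} _ (refl , eq) t∈ = sound-stay {p = p} eq t∈
  sound {suc r , k} {p = p} _ (refl , eq) (there t∈) = sound-stay {p = p} eq t∈
  sound {suc r , k} _ (refl , eq) (here refl)
    rewrite ℕ.m≤n⇒m⊔n≡n (ℕ.n≤1+n k) = ℕ.≤-refl , refl , trans (ℕ.+-suc r k) eq

  complete : ∀ {s k p x} → Prefix k p → Inv s k p → x ≤ k → ¬ (upTo (suc M) ⊆ p ∷ʳ x) →
             ∃[ s′ ] (x , s′) ∈ δ-increasing s
  complete {r , k} _ _ x≤k _ with ℕ.m≤n⇒m<n∨m≡n x≤k
  -- With `r` zero there are already `M` letters, and a new one would complete `upTo (suc M)`.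
  complete {zero  , k} {p = p} pre (refl , refl) _ good | inj₂ refl =
    contradiction (subst (_⊆ p ∷ʳ k) (upTo-∷ʳ k) (snoc⁺ (proj₂ pre))) good
  complete {suc r , k} _ (refl , _) _ _ | inj₂ refl = _ , here refl
  complete {zero  , k} _ (refl , _) _ _ | inj₁ x<k = _ , ∈-map⁺ (stay zero k) (∈-upTo⁺ x<k)
  complete {suc r , k} _ (refl , _) _ _ | inj₁ x<k =
    _ , there (∈-map⁺ (stay (suc r) k) (∈-upTo⁺ x<k))

-- The pattern 12...m: words with bounded repetition

All≡⇒replicate : ∀ {a : ℕ} {s} → All (_≡ a) s → s ≡ replicate (length s) a
All≡⇒replicate []         = refl
All≡⇒replicate (refl ∷ e) = cong (_ ∷_) (All≡⇒replicate e)

deduplicate-replicate : ∀ m a → deduplicate ℕ._≟_ (replicate (suc m) a) ≡ [ a ]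
deduplicate-replicate zero    a = refl
deduplicate-replicate (suc m) a = cong (a ∷_) (trans
  (cong (filter (¬? ∘ (a ℕ.≟_))) (deduplicate-replicate m a))
  (filter-reject (¬? ∘ (a ℕ.≟_)) (λ a≢a → a≢a refl)))

standardize-replicate : ∀ m → standardize (replicate m 0) ≡ replicate m 1
standardize-replicate zero    = refl
standardize-replicate (suc m) = trans (map-replicate (rank (replicate (suc m) 0)) (suc m) 0)
  (cong (λ xs → replicate (suc m) (count≤ 0 xs)) (deduplicate-replicate m 0))

Repeats : ℕ → List ℕ → Set
Repeats m w = ∃[ a ] replicate m a ⊆ w

detects-constant : ∀ M → Detects (replicate (suc M) 1) (Repeats (suc M))
detects-constant M = record
  { extend       = λ w (a , sub) → a , ++⁺ʳ w sub
  ; bad⇒contains = λ {w} (a , sub) → subst (Contains (map suc w)) (standardize-replicate (suc M))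
      -- A strictly increasing map taking 0 to `a` is wanted; any second value above `a` would do.
      (contains⁺ {s = replicate (suc M) 0} (spread-mono (ℕ.n<1+n a))
        (subst (_⊆ w) (sym (map-replicate (spread a (suc a)) (suc M) 0)) sub))
  ; contains⇒bad = λ _ → contains⇒bad
  }
  where
  contains⇒bad : ∀ {w} → Contains (map suc w) (replicate (suc M) 1) → Repeats (suc M) w
  contains⇒bad {w} c with contains⁻ c
  ... | s@(a ∷ _) , sub , eq = a , subst (λ l → replicate l a ⊆ w) length-s
          (subst (_⊆ w) (All≡⇒replicate same) sub)
    where
    ranks : All (λ v → rank s v ≡ 1) s
    ranks = All.map⁻ (subst (All (_≡ 1)) (sym eq) (All.replicate⁺ (suc M) refl))

    same : All (_≡ a) s
    same = All.tabulate λ v∈ →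
      rank-injective v∈ (here refl) (trans (All.lookup ranks v∈) (sym (All.head ranks)))

    length-s : length s ≡ suc M
    length-s = trans (sym (length-map (rank s) s))
      (trans (cong length eq) (length-replicate (suc M)))

occurrences : ℕ → List ℕ → ℕ
occurrences a p = length (filter (a ℕ.≟_) p)

occurrences-≡ : ∀ a p → occurrences a (p ∷ʳ a) ≡ suc (occurrences a p)
occurrences-≡ a p = begin
  length (filter (a ℕ.≟_) (p ∷ʳ a))
    ≡⟨ cong length (filter-++ (a ℕ.≟_) p [ a ]) ⟩
  length (filter (a ℕ.≟_) p ++ filter (a ℕ.≟_) [ a ])
    ≡⟨ cong (λ l → length (filter (a ℕ.≟_) p ++ l)) (filter-accept (a ℕ.≟_) refl) ⟩
  length (filter (a ℕ.≟_) p ∷ʳ a)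
    ≡⟨ length-∷ʳ a (filter (a ℕ.≟_) p) ⟩
  suc (occurrences a p) ∎
  where
  open ≡-Reasoning
  length-∷ʳ : ∀ x (xs : List ℕ) → length (xs ∷ʳ x) ≡ suc (length xs)
  length-∷ʳ x xs = trans (length-++ xs) (ℕ.+-comm (length xs) 1)

occurrences-≢ : ∀ {a x} p → a ≢ x → occurrences a (p ∷ʳ x) ≡ occurrences a p
occurrences-≢ {a} {x} p a≢x = begin
  length (filter (a ℕ.≟_) (p ∷ʳ x))
    ≡⟨ cong length (filter-++ (a ℕ.≟_) p [ x ]) ⟩
  length (filter (a ℕ.≟_) p ++ filter (a ℕ.≟_) [ x ])
    ≡⟨ cong (λ l → length (filter (a ℕ.≟_) p ++ l)) (filter-reject (a ℕ.≟_) a≢x) ⟩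
  length (filter (a ℕ.≟_) p ++ [])
    ≡⟨ cong length (++-identityʳ (filter (a ℕ.≟_) p)) ⟩
  occurrences a p ∎
  where open ≡-Reasoning

repeats⇒occurrences : ∀ m {a} → replicate m a ⊆ p → m ≤ occurrences a p
repeats⇒occurrences {p} m {a} sub = subst (_≤ occurrences a p)
  (trans (cong length (filter-all (a ℕ.≟_) (All.replicate⁺ m refl))) (length-replicate m))
  (length-mono-≤ (filter⁺ (a ℕ.≟_) (a ℕ.≟_) (λ { refl → id }) sub))

occurrences⇒repeats : ∀ m {a} p → m ≤ occurrences a p → replicate m a ⊆ p
occurrences⇒repeats m {a} p m≤ = ⊆-trans (replicate-mono m≤)
  (subst (_⊆ p) (All≡⇒replicate (All.map sym (All.all-filter (a ℕ.≟_) p))) (filter-⊆ (a ℕ.≟_) p))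
  where
  replicate-mono : ∀ {m n} → m ≤ n → replicate m a ⊆ replicate n a
  replicate-mono z≤n     = minimum _
  replicate-mono (s≤s l) = refl ∷ replicate-mono l

-- A state lists how many more elements each block may still receive, a new
-- block having room for M.
module Capacities (M : ℕ) where

  State : Set
  State = List ℕ

  use : ℕ → State → List (ℕ × State)
  use zero    cs = []
  use (suc t) cs = [ 0 , t ∷ cs ]

  skip : ℕ → ℕ × State → ℕ × State
  skip c (x , cs) = suc x , c ∷ cs

  δ : State → List (ℕ × State)
  δ []       = use M []
  δ (c ∷ cs) = use c cs ++ map (skip c) (δ cs)

  -- The default `M` stands for blocks not yet opened, so that occurrences and capacity add up to
  -- `M` for every letter, used or not.
  capacity : State → ℕ → ℕ
  capacity []       a       = M
  capacity (c ∷ cs) zero    = c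
  capacity (c ∷ cs) (suc a) = capacity cs a

  δ-unique : ∀ cs → Unique (map proj₁ (δ cs))
  δ-unique [] = use-unique M
    where
    use-unique : ∀ t → Unique (map proj₁ (use t []))
    use-unique zero    = []
    use-unique (suc _) = [] ∷ []
  δ-unique (c ∷ cs) = lemma c
    where
    tails : map proj₁ (map (skip c) (δ cs)) ≡ map suc (map proj₁ (δ cs))
    tails = trans (sym (map-∘ (δ cs))) (map-∘ (δ cs))

    tails-unique : Unique (map proj₁ (map (skip c) (δ cs)))
    tails-unique = subst Unique (sym tails) (Unique.map⁺ ℕ.suc-injective (δ-unique cs))

    lemma : ∀ t → Unique (map proj₁ (use t cs ++ map (skip c) (δ cs)))
    lemma zero    = tails-unique
    lemma (suc t) =
      subst (All (0 ≢_)) (sym tails) (All.map⁺ (All.universal (λ _ ()) _)) ∷ tails-unique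

  record Step (cs : State) (x : ℕ) (cs′ : State) : Set where
    field
      x≤length : x ≤ length cs
      length′  : length cs′ ≡ length cs ⊔ suc x
      used     : capacity cs x ≡ suc (capacity cs′ x)
      others   : ∀ a → a ≢ x → capacity cs a ≡ capacity cs′ a

  step-use : ∀ t cs {x cs′} → (x , cs′) ∈ use t cs → Step (t ∷ cs) x cs′
  step-use (suc t) cs (here refl) = record
    { x≤length = z≤n
    ; length′  = cong suc (sym (ℕ.⊔-identityʳ (length cs)))
    ; used     = refl
    ; others   = λ { zero 0≢0 → contradiction refl 0≢0 ; (suc a) _ → refl }
    }

  step-skip : ∀ {c cs x cs′} → Step cs x cs′ → Step (c ∷ cs) (suc x) (c ∷ cs′)
  step-skip st = record
    { x≤length = s≤s x≤length
    ; length′  = cong suc length′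
    ; used     = used
    ; others   = λ { zero _ → refl ; (suc a) a≢x → others a (a≢x ∘ cong suc) }
    }
    where open Step st

  δ⇒step : ∀ cs {x cs′} → (x , cs′) ∈ δ cs → Step cs x cs′
  δ⇒step [] t∈ = new M refl t∈
    where
    -- `M` is a module parameter; `t` takes its place so that it can be matched on, and the equation
    -- then supplies `used`.
    new : ∀ t {x cs′} → M ≡ t → (x , cs′) ∈ use t [] → Step [] x cs′
    new (suc t) eq (here refl) = record
      { x≤length = z≤n
      ; length′  = refl
      ; used     = eq
      ; others   = λ { zero 0≢0 → contradiction refl 0≢0 ; (suc a) _ → refl }
      }
  δ⇒step (c ∷ cs) t∈ with ∈-++⁻ (use c cs) t∈
  ... | inj₁ t∈′ = step-use c cs t∈′
  ... | inj₂ t∈′ with _ , t∈″ , refl ← ∈-map⁻ (skip c) t∈′ = step-skip (δ⇒step cs t∈″)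

  step⇒δ : ∀ cs {x t} → x ≤ length cs → capacity cs x ≡ suc t → ∃[ cs′ ] (x , cs′) ∈ δ cs
  step⇒δ []           z≤n refl       = _ , here refl
  step⇒δ (suc t ∷ cs) {zero}  _ refl = _ , here refl
  step⇒δ (c ∷ cs)     {suc x} x≤ eq  =
    let (_ , t∈) = step⇒δ cs (s≤s⁻¹ x≤) eq in _ , ∈-++⁺ʳ (use c cs) (∈-map⁺ (skip c) t∈)

  recogniser : Recogniser (Repeats (suc M))
  recogniser = record
    { State    = State
    ; δ        = δ
    ; start    = []
    ; Inv      = Inv
    ; δ-unique = δ-unique
    ; start-ok = refl , λ _ → refl
    ; safe     = λ {cs} {k} {p} _ (_ , total) (a , sub) →
        ℕ.<⇒≱ (repeats⇒occurrences (suc M) sub)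
          (subst (occurrences a p ≤_) (total a) (ℕ.m≤m+n _ (capacity cs a)))
    ; sound    = λ {cs} → sound {cs}
    ; complete = λ {cs} → complete {cs}
    }
    where
    Inv : State → ℕ → List ℕ → Set
    Inv cs k p = length cs ≡ k × ∀ a → occurrences a p + capacity cs a ≡ M

    sound : ∀ {cs k p x cs′} → Prefix k p → Inv cs k p → (x , cs′) ∈ δ cs →
            x ≤ k × Inv cs′ (k ⊔ suc x) (p ∷ʳ x)
    sound {cs} {p = p} {x} {cs′} _ (refl , total) t∈ = x≤length , length′ , total′
      where
      open Step (δ⇒step cs t∈)
      total′ : ∀ a → occurrences a (p ∷ʳ x) + capacity cs′ a ≡ M
      total′ a with a ℕ.≟ x
      ... | yes refl = begin
        occurrences a (p ∷ʳ a) + capacity cs′ a ≡⟨ cong (_+ capacity cs′ a) (occurrences-≡ a p) ⟩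
        suc (occurrences a p) + capacity cs′ a  ≡⟨ ℕ.+-suc (occurrences a p) (capacity cs′ a) ⟨
        occurrences a p + suc (capacity cs′ a)  ≡⟨ cong (_+_ (occurrences a p)) used ⟨
        occurrences a p + capacity cs a         ≡⟨ total a ⟩
        M                                       ∎
        where open ≡-Reasoning
      ... | no a≢x = trans (cong₂ _+_ (occurrences-≢ p a≢x) (sym (others a a≢x))) (total a)

    complete : ∀ {cs k p x} → Prefix k p → Inv cs k p → x ≤ k → ¬ Repeats (suc M) (p ∷ʳ x) →
               ∃[ cs′ ] (x , cs′) ∈ δ cs
    complete {cs} {p = p} {x} _ (refl , total) x≤k good with capacity cs x in eq
    ... | suc t = step⇒δ cs x≤k eq
    ... | zero  = contradiction (x , occurrences⇒repeats (suc M) (p ∷ʳ x) enough) good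
      where
      enough : suc M ≤ occurrences x (p ∷ʳ x)
      enough = ℕ.≤-reflexive (sym (trans (occurrences-≡ x p) (cong suc
        (trans (sym (ℕ.+-identityʳ _)) (trans (cong (_+_ (occurrences x p)) (sym eq)) (total x))))))

-- Recurrences

-- The offset `o` is separate from the evaluation point `x`: recursion along the list advances the
-- one and fixes the other.
recur : List Poly → ℤ → (ℕ → ℤ) → ℕ → ℤ
recur []       x a o = 0ℤ
recur (p ∷ ps) x a o = eval p x ℤ.* a o ℤ.+ recur ps x a (suc o)

recur-sum : ∀ ps x a o →
            sumℤ (λ i → eval (List.lookup ps i) x ℤ.* a (o + toℕ i)) ≡ recur ps x a o
recur-sum []       x a o = refl
recur-sum (p ∷ ps) x a o = cong₂ ℤ._+_ (cong (λ i → eval p x ℤ.* a i) (ℕ.+-identityʳ o))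
  (trans (sum-cong λ i → cong (λ j → eval (List.lookup ps i) x ℤ.* a j) (ℕ.+-suc o (toℕ i)))
         (recur-sum ps x a (suc o)))

pRecursive : ∀ a ps → Any (¬_ ∘ IsZero) ps → (∀ n → recur ps (+ n) a n ≡ 0ℤ) → PRecursive a
pRecursive a (p ∷ ps) nonzero recurrence =
  length ps , List.lookup (p ∷ ps) ,
  (λ zero → Any.lookup-index nonzero (zero (Any.index nonzero))) ,
  λ n → trans (recur-sum (p ∷ ps) (+ n) a n) (recurrence n)

recur-∷ʳ : ∀ ps p x a o →
           recur (ps ∷ʳ p) x a o ≡ recur ps x a o ℤ.+ eval p x ℤ.* a (o + length ps)
recur-∷ʳ []       p x a o rewrite ℕ.+-identityʳ o = ℤ.+-comm (eval p x ℤ.* a o) 0ℤ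
recur-∷ʳ (q ∷ ps) p x a o rewrite recur-∷ʳ ps p x a (suc o) | ℕ.+-suc o (length ps) =
  sym (ℤ.+-assoc (eval q x ℤ.* a o) _ _)

-- The coefficient list of b + (X - c) p, for a coefficient list p.
addTimesLinear : ℤ → ℤ → Poly → Poly
addTimesLinear c b []      = [ b ]
addTimesLinear c b (d ∷ p) = (b ℤ.- c ℤ.* d) ∷ addTimesLinear c d p

-- The induction rests on b + (X - c)(d + X p) = (b - c d) + X (d + (X - c) p), whose inner bracket
-- has the same shape; hence the extra constant `b`.
eval-addTimesLinear : ∀ c b p x →
  eval (addTimesLinear c b p) x ≡ b ℤ.+ (x ℤ.- c) ℤ.* eval p x
eval-addTimesLinear c b []      x = lemma b c x
  where
  lemma : ∀ b c x → b ℤ.+ x ℤ.* 0ℤ ≡ b ℤ.+ (x ℤ.- c) ℤ.* 0ℤ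
  lemma = ring
eval-addTimesLinear c b (d ∷ p) x rewrite eval-addTimesLinear c d p x = lemma b c d x (eval p x)
  where
  lemma : ∀ b c d x e → (b ℤ.- c ℤ.* d) ℤ.+ x ℤ.* (d ℤ.+ (x ℤ.- c) ℤ.* e) ≡
                        b ℤ.+ (x ℤ.- c) ℤ.* (d ℤ.+ x ℤ.* e)
  lemma = ring

-- The polynomial cs in the shift operator, applied to the sequence a.
applyShift : Poly → (ℕ → ℤ) → ℕ → ℤ
applyShift []       a o = 0ℤ
applyShift (c ∷ cs) a o = c ℤ.* a o ℤ.+ applyShift cs a (suc o)

applyShift-cong : ∀ cs {a b} → (∀ n → a n ≡ b n) → ∀ o → applyShift cs a o ≡ applyShift cs b o
applyShift-cong []       a≗b o = refl
applyShift-cong (c ∷ cs) a≗b o =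
  cong₂ (λ x y → c ℤ.* x ℤ.+ y) (a≗b o) (applyShift-cong cs a≗b (suc o))

-- Constant coefficients commute with the shift E, so the factor E - c may act first. With `b` zero,
-- an annihilator of (E - c) a thereby gives one of `a`.
applyShift-addTimesLinear : ∀ c b cs a o →
  applyShift (addTimesLinear c b cs) a o ≡
  b ℤ.* a o ℤ.+ applyShift cs (λ n → a (suc n) ℤ.- c ℤ.* a n) o
applyShift-addTimesLinear c b []       a o = refl
applyShift-addTimesLinear c b (d ∷ cs) a o
  rewrite applyShift-addTimesLinear c d cs a (suc o) = lemma b c d (a o) (a (suc o)) _
  where
  lemma : ∀ b c d x y z → (b ℤ.- c ℤ.* d) ℤ.* x ℤ.+ (d ℤ.* y ℤ.+ z) ≡
                          b ℤ.* x ℤ.+ (d ℤ.* (y ℤ.- c ℤ.* x) ℤ.+ z)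
  lemma = ring

recur-constants : ∀ cs x a o → recur (map [_] cs) x a o ≡ applyShift cs a o
recur-constants []       x a o = refl
recur-constants (c ∷ cs) x a o =
  cong₂ (λ d z → d ℤ.* a o ℤ.+ z)
    (trans (cong (ℤ._+_ c) (ℤ.*-zeroʳ x)) (ℤ.+-identityʳ c)) (recur-constants cs x a (suc o))

-- A monic shift polynomial is required because its leading 1 certifies that the coefficients are
-- not all zero.
cRecursive⇒pRecursive : ∀ a cs → (∀ n → applyShift (cs ∷ʳ 1ℤ) a n ≡ 0ℤ) → PRecursive a
cRecursive⇒pRecursive a cs recurrence = pRecursive a (map [_] (cs ∷ʳ 1ℤ))
  (Any.map⁺ (Any.++⁺ʳ cs (here λ { (() ∷ _) })))
  (λ n → trans (recur-constants (cs ∷ʳ 1ℤ) (+ n) a n) (recurrence n))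

powersOf2 : (a : ℕ → ℕ) → (∀ n → a (suc n) ≡ 2 ^ n) → PRecursive (+_ ∘ a)
-- The operator is E² - 2E and not E - 2: the hypothesis starts at `a 1`, and the sequences in
-- question have `a 0` and `a 1` both equal to 1.
powersOf2 a a≡ = cRecursive⇒pRecursive (+_ ∘ a) (0ℤ ∷ ℤ.- + 2 ∷ []) recurrence
  where
  lemma : ∀ x y → 0ℤ ℤ.* x ℤ.+ (ℤ.- + 2 ℤ.* y ℤ.+ (1ℤ ℤ.* (+ 2 ℤ.* y) ℤ.+ 0ℤ)) ≡ 0ℤ
  lemma = ring

  recurrence : ∀ n → applyShift (0ℤ ∷ ℤ.- + 2 ∷ 1ℤ ∷ []) (+_ ∘ a) n ≡ 0ℤ
  recurrence n = trans
    (cong₂ (λ y z → 0ℤ ℤ.* + a n ℤ.+ (ℤ.- + 2 ℤ.* y ℤ.+ (1ℤ ℤ.* z ℤ.+ 0ℤ)))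
      (cong +_ (a≡ n)) (trans (cong +_ (a≡ (suc n))) (ℤ.pos-* 2 (2 ^ n))))
    (lemma (+ a n) (+ (2 ^ n)))

-- Counting for the patterns of length three

module _ {Bad : List ℕ → Set} (L : OneOldLetter Bad) where

  open Recogniser (OneOldLetter.recogniser L) using (count)

  count-oneOldLetter : ∀ j n → count (suc j) n ≡ 2 ^ n
  count-oneOldLetter j zero    = refl
  count-oneOldLetter j (suc n) =
    cong₂ (λ x y → x + (y + 0)) (count-oneOldLetter j n) (count-oneOldLetter (suc j) n)

module Count112 where
  open Recogniser recogniser-112 using (count)

  branches : ℕ → ℕ → ℕ
  branches k n = sum (map (λ (_ , s) → count s n) (map decrease (upTo k)))

  branches-suc : ∀ k n → branches (suc k) n ≡ branches k n + count (decreasing k) n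
  branches-suc k n = begin
    sum (map f (map decrease (upTo (suc k))))   ≡⟨ cong sum (map-∘ (upTo (suc k))) ⟨
    sum (map (f ∘ decrease) (upTo (suc k)))     ≡⟨ cong (sum ∘ map (f ∘ decrease)) (upTo-∷ʳ k) ⟨
    sum (map (f ∘ decrease) (upTo k ∷ʳ k))      ≡⟨ cong sum (map-++ (f ∘ decrease) (upTo k) [ k ]) ⟩
    sum (map (f ∘ decrease) (upTo k) ∷ʳ f (decrease k)) ≡⟨ sum-++ (map (f ∘ decrease) (upTo k)) _ ⟩
    sum (map (f ∘ decrease) (upTo k)) + (f (decrease k) + 0)
      ≡⟨ cong₂ _+_ (cong sum (map-∘ (upTo k))) (ℕ.+-identityʳ _) ⟩
    branches k n + count (decreasing k) n       ∎
    where
    open ≡-Reasoning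
    f : ℕ × State112 → ℕ
    f (_ , s) = count s n

  -- The counts depend on the state, so induction on the powers of 2 alone does not close. This
  -- relation does close, because `count (decreasing k) (suc n)` is again `branches (suc k) n`; at
  -- `k` = 0 it becomes doubling.
  pascal : ∀ n k → count (increasing (suc k)) (suc n) ≡
                   count (increasing k) (suc n) + count (increasing (suc k)) n
  pascal zero k rewrite branches-suc k 0 = lemma (branches k 0)
    where
    lemma : ∀ b → 1 + (b + 1) ≡ (1 + b) + 1
    lemma = solve-∀
  pascal (suc n) k rewrite pascal n (suc k) | branches-suc k (suc n) = lemma
    (count (increasing (suc k)) (suc n)) (count (increasing (suc (suc k))) n)
    (branches k (suc n)) (branches (suc k) n)
    where
    lemma : ∀ x y z w → (x + y) + (z + w) ≡ (x + z) + (y + w)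
    lemma = solve-∀

  count-increasing : ∀ n → count (increasing 1) n ≡ 2 ^ n
  count-increasing zero    = refl
  count-increasing (suc n) = trans (pascal n 0) (trans
    (cong (λ x → x + 0 + x) (count-increasing n)) (lemma (2 ^ n)))
    where
    lemma : ∀ x → x + 0 + x ≡ 2 * x
    lemma = solve-∀

-- The constant-coefficient recurrence for 1/2/.../m

module CountIncreasing (M : ℕ) where
  open Recogniser (recogniser-increasing M) using (count)

  branches : ∀ r k n ks →
             sum (map (λ (_ , s) → count s n) (map (stay r k) ks)) ≡ length ks * count (r , k) n
  branches r k n []       = refl
  branches r k n (x ∷ ks) = cong (_+_ (count (r , k) n)) (branches r k n ks)

  branches-upTo : ∀ r k n → sum (map (λ (_ , s) → count s n) (map (stay r k) (upTo k))) ≡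
                            k * count (r , k) n
  branches-upTo r k n = trans (branches r k n (upTo k))
    (cong (_* count (r , k) n) (length-upTo k))

  newBlocks : ℕ → ℕ → ℕ → ℕ
  newBlocks zero    k n = 0
  newBlocks (suc r) k n = count (r , suc k) n

  count-suc : ∀ r k n → count (r , k) (suc n) ≡ newBlocks r k n + k * count (r , k) n
  count-suc zero    k n = branches-upTo zero k n
  count-suc (suc r) k n = cong (_+_ (count (r , suc k) n)) (branches-upTo (suc r) k n)

  -- A factor X - c preserves the leading coefficient, which keeps the annihilators in `cRecursive`
  -- monic.
  addTimesLinear-∷ʳ : ∀ c b p d → ∃[ q ] addTimesLinear c b (p ∷ʳ d) ≡ q ∷ʳ d
  addTimesLinear-∷ʳ c b []      d = [ _ ] , refl
  addTimesLinear-∷ʳ c b (e ∷ p) d =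
    let (q , eq) = addTimesLinear-∷ʳ c e p d in _ ∷ q , cong (_ ∷_) eq

  -- E − k leaves only newBlocks, which is again of this form with one r fewer.
  cRecursive : ∀ r k → ∃[ cs ] (∀ o → applyShift (cs ∷ʳ 1ℤ) (+_ ∘ count (r , k)) o ≡ 0ℤ)
  cRecursive r k =
    let (cs , annihilates) = rest r
        (q , eq)           = addTimesLinear-∷ʳ (+ k) 0ℤ cs 1ℤ
    in q , λ o → begin
      applyShift (q ∷ʳ 1ℤ) a o ≡⟨ cong (λ p → applyShift p a o) eq ⟨
      applyShift (addTimesLinear (+ k) 0ℤ (cs ∷ʳ 1ℤ)) a o
        ≡⟨ applyShift-addTimesLinear (+ k) 0ℤ (cs ∷ʳ 1ℤ) a o ⟩
      0ℤ ℤ.* a o ℤ.+ applyShift (cs ∷ʳ 1ℤ) (λ n → a (suc n) ℤ.- + k ℤ.* a n) o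
        ≡⟨ ℤ.+-identityˡ _ ⟩
      applyShift (cs ∷ʳ 1ℤ) (λ n → a (suc n) ℤ.- + k ℤ.* a n) o
        ≡⟨ applyShift-cong (cs ∷ʳ 1ℤ) difference o ⟩
      applyShift (cs ∷ʳ 1ℤ) (+_ ∘ newBlocks r k) o ≡⟨ annihilates o ⟩
      0ℤ ∎
    where
    open ≡-Reasoning
    a : ℕ → ℤ
    a n = + count (r , k) n

    rest : ∀ r → ∃[ cs ] (∀ o → applyShift (cs ∷ʳ 1ℤ) (+_ ∘ newBlocks r k) o ≡ 0ℤ)
    -- When no block may be opened, `newBlocks` is the zero sequence, annihilated by the constant
    -- polynomial 1.
    rest zero    = [] , λ _ → refl
    rest (suc r) = cRecursive r (suc k)

    difference : ∀ n → a (suc n) ℤ.- + k ℤ.* a n ≡ + newBlocks r k n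
    difference n = begin
      a (suc n) ℤ.- + k ℤ.* a n
        ≡⟨ cong (λ x → + x ℤ.- + k ℤ.* a n) (count-suc r k n) ⟩
      + newBlocks r k n ℤ.+ + (k * count (r , k) n) ℤ.- + k ℤ.* a n
        ≡⟨ cong (λ x → + newBlocks r k n ℤ.+ x ℤ.- + k ℤ.* a n) (ℤ.pos-* k (count (r , k) n)) ⟩
      + newBlocks r k n ℤ.+ + k ℤ.* a n ℤ.- + k ℤ.* a n
        ≡⟨ lemma (+ newBlocks r k n) (+ k ℤ.* a n) ⟩
      + newBlocks r k n ∎
      where
      lemma : ∀ x y → x ℤ.+ y ℤ.- y ≡ x
      lemma = ring

  pRecursive-increasing : PRecursive (+_ ∘ count (M , 0))
  pRecursive-increasing =
    let (cs , annihilates) = cRecursive M 0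
    in cRecursive⇒pRecursive (+_ ∘ count (M , 0)) cs annihilates

-- Binomial sums and the recurrence for 12...m

-- The sum of C(n,i) g(n-i) over i ≤ t; C(n,i) vanishes where n-i is truncated.
binomialSum : ℕ → ℕ → (ℕ → ℕ) → ℕ
binomialSum zero    n g = g n
binomialSum (suc t) n g = (n C suc t) * g (n ∸ suc t) + binomialSum t n g

nC0≡1 : ∀ n → n C 0 ≡ 1
nC0≡1 n = trans (nCk≡nC[n∸k] {0} {n} z≤n) (nCn≡1 n)

binomial-term : ∀ n t (g : ℕ → ℕ) → (suc n C suc t) * g (n ∸ t) ≡
                (n C suc t) * g (suc (n ∸ suc t)) + (n C t) * g (n ∸ t)
binomial-term n t g = begin
  (suc n C suc t) * g (n ∸ t)
    ≡⟨ cong (_* g (n ∸ t)) (nCk+nC[k+1]≡[n+1]C[k+1] n t) ⟨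
  (n C t + n C suc t) * g (n ∸ t)
    ≡⟨ trans (ℕ.*-distribʳ-+ (g (n ∸ t)) (n C t) (n C suc t))
         (ℕ.+-comm ((n C t) * g (n ∸ t)) ((n C suc t) * g (n ∸ t))) ⟩
  (n C suc t) * g (n ∸ t) + (n C t) * g (n ∸ t)
    ≡⟨ cong (_+ (n C t) * g (n ∸ t)) untruncated ⟩
  (n C suc t) * g (suc (n ∸ suc t)) + (n C t) * g (n ∸ t) ∎
  where
  open ≡-Reasoning
  untruncated : (n C suc t) * g (n ∸ t) ≡ (n C suc t) * g (suc (n ∸ suc t))
  untruncated with t ℕ.<? n
  ... | yes t<n = cong (λ i → (n C suc t) * g i) (ℕ.+-∸-assoc 1 t<n)
  -- Truncation makes the two arguments of `g` differ (0 and 1), but their coefficient C(n, t+1)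
  -- vanishes.
  ... | no t≮n rewrite k>n⇒nCk≡0 (s≤s (ℕ.≮⇒≥ t≮n)) = refl

-- Pascal's rule in each summand. In terms of words: the next element either joins the block,
-- leaving one place fewer, or goes elsewhere, which advances `g`.
binomialSum-suc : ∀ t n g → binomialSum (suc t) (suc n) g ≡
                  binomialSum t n g + binomialSum (suc t) n (g ∘ suc)
binomialSum-suc zero n g rewrite binomial-term n 0 g | nC0≡1 n =
  lemma ((n C 1) * g (suc (n ∸ 1))) (g n) (g (suc n))
  where
  lemma : ∀ x y z → (x + 1 * y) + z ≡ y + (x + z)
  lemma = solve-∀
binomialSum-suc (suc t) n g rewrite binomialSum-suc t n g | binomial-term n (suc t) g =
  lemma ((n C suc (suc t)) * g (suc (n ∸ suc (suc t)))) ((n C suc t) * g (n ∸ suc t))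
        (binomialSum t n g) _
  where
  lemma : ∀ x y z w → (x + y) + (z + w) ≡ (y + z) + (x + w)
  lemma = solve-∀

binomialSum-zero : ∀ t n → binomialSum t n (λ _ → 0) ≡ 0
binomialSum-zero zero    n = refl
binomialSum-zero (suc t) n = cong₂ _+_ (ℕ.*-zeroʳ (n C suc t)) (binomialSum-zero t n)

binomialSum-+ : ∀ t n g h →
  binomialSum t n (λ i → g i + h i) ≡ binomialSum t n g + binomialSum t n h
binomialSum-+ zero    n g h = refl
binomialSum-+ (suc t) n g h rewrite binomialSum-+ t n g h =
  lemma (n C suc t) (g (n ∸ suc t)) (h (n ∸ suc t)) (binomialSum t n g) (binomialSum t n h)
  where
  lemma : ∀ c x y u v → c * (x + y) + (u + v) ≡ (c * x + u) + (c * y + v)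
  lemma = solve-∀

binomialSum-sum : ∀ {A : Set} t n (f : A → ℕ → ℕ) xs →
  binomialSum t n (λ i → sum (map (λ x → f x i) xs)) ≡ sum (map (λ x → binomialSum t n (f x)) xs)
binomialSum-sum t n f []       = binomialSum-zero t n
binomialSum-sum t n f (x ∷ xs) = trans (binomialSum-+ t n (f x) _)
  (cong (_+_ (binomialSum t n (f x))) (binomialSum-sum t n f xs))

-- The identity (k+1) C(n,k+1) = (n-k) C(n,k) without subtraction, hence valid in ℕ for k > n too.
-- It is the recursion behind `binomialPoly`.
binomial-absorb : ∀ n k → suc k * (n C suc k) + k * (n C k) ≡ n * (n C k)
binomial-absorb zero    zero    = refl
binomial-absorb zero    (suc k)
  rewrite k>n⇒nCk≡0 {0} {suc k} (s≤s z≤n) | k>n⇒nCk≡0 {0} {suc (suc k)} (s≤s z≤n) =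
  cong₂ _+_ (ℕ.*-zeroʳ (suc (suc k))) (ℕ.*-zeroʳ (suc k))
binomial-absorb (suc n) zero = begin
  1 * (suc n C 1) + 0         ≡⟨ cong (λ c → 1 * c + 0) (nCk+nC[k+1]≡[n+1]C[k+1] n 0) ⟨
  1 * (n C 0 + n C 1) + 0     ≡⟨ lemma (n C 0) (n C 1) ⟩
  n C 0 + (1 * (n C 1) + 0)   ≡⟨ cong (_+_ (n C 0)) (binomial-absorb n 0) ⟩
  suc n * (n C 0)             ≡⟨ cong (suc n *_) (trans (nC0≡1 n) (sym (nC0≡1 (suc n)))) ⟩
  suc n * (suc n C 0)         ∎
  where
  open ≡-Reasoning
  lemma : ∀ x y → 1 * (x + y) + 0 ≡ x + (1 * y + 0)
  lemma = solve-∀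
binomial-absorb (suc n) (suc k)
  rewrite sym (nCk+nC[k+1]≡[n+1]C[k+1] n k) | sym (nCk+nC[k+1]≡[n+1]C[k+1] n (suc k)) = begin
  suc (suc k) * (c₁ + c₂) + suc k * (c₀ + c₁) ≡⟨ lemma₁ k c₀ c₁ c₂ ⟩
  (suc (suc k) * c₂ + suc k * c₁) + (suc k * c₁ + k * c₀) + (c₀ + c₁)
    ≡⟨ cong₂ (λ u v → u + v + (c₀ + c₁)) (binomial-absorb n (suc k)) (binomial-absorb n k) ⟩
  n * c₁ + n * c₀ + (c₀ + c₁) ≡⟨ lemma₂ n c₀ c₁ ⟩
  suc n * (c₀ + c₁) ∎
  where
  open ≡-Reasoning
  c₀ = n C k
  c₁ = n C suc k
  c₂ = n C suc (suc k)
  lemma₁ : ∀ k x y z → suc (suc k) * (y + z) + suc k * (x + y) ≡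
                       (suc (suc k) * z + suc k * y) + (suc k * y + k * x) + (x + y)
  lemma₁ = solve-∀
  lemma₂ : ∀ n x y → n * y + n * x + (x + y) ≡ suc n * (x + y)
  lemma₂ = solve-∀

scale : ℤ → Poly → Poly
scale c = map (c ℤ.*_)

eval-scale : ∀ c p x → eval (scale c p) x ≡ c ℤ.* eval p x
eval-scale c []      x = sym (ℤ.*-zeroʳ c)
eval-scale c (d ∷ p) x rewrite eval-scale c p x = lemma c d x (eval p x)
  where
  lemma : ∀ c d x e → c ℤ.* d ℤ.+ x ℤ.* (c ℤ.* e) ≡ c ℤ.* (d ℤ.+ x ℤ.* e)
  lemma = ring

recur-scale : ∀ c ps x a o → recur (map (scale c) ps) x a o ≡ c ℤ.* recur ps x a o
recur-scale c []       x a o = sym (ℤ.*-zeroʳ c)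
recur-scale c (p ∷ ps) x a o rewrite eval-scale c p x | recur-scale c ps x a (suc o) =
  lemma c (eval p x) (a o) (recur ps x a (suc o))
  where
  lemma : ∀ c p a r → c ℤ.* p ℤ.* a ℤ.+ c ℤ.* r ≡ c ℤ.* (p ℤ.* a ℤ.+ r)
  lemma = ring

module BinomialRecurrence (M : ℕ) where

  -- The falling factorial (X+M)(X+M-1)⋯(X+M-t+1), that is t! C(X+M,t). Moving the argument by `M`
  -- lets the recurrence at n reach only forward.
  binomialPoly : ℕ → Poly
  binomialPoly zero    = [ 1ℤ ]
  binomialPoly (suc t) = addTimesLinear (+ t ℤ.- + M) 0ℤ (binomialPoly t)

  eval-binomialPoly : ∀ t n → eval (binomialPoly t) (+ n) ≡ + (t ! * ((n + M) C t))
  eval-binomialPoly zero    n rewrite nC0≡1 (n + M) = cong (ℤ._+_ 1ℤ) (ℤ.*-zeroʳ (+ n))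
  eval-binomialPoly (suc t) n = begin
    eval (binomialPoly (suc t)) (+ n)
      ≡⟨ eval-addTimesLinear (+ t ℤ.- + M) 0ℤ (binomialPoly t) (+ n) ⟩
    0ℤ ℤ.+ (+ n ℤ.- (+ t ℤ.- + M)) ℤ.* eval (binomialPoly t) (+ n)
      ≡⟨ cong (λ e → 0ℤ ℤ.+ (+ n ℤ.- (+ t ℤ.- + M)) ℤ.* e)
              (trans (eval-binomialPoly t n) (ℤ.pos-* (t !) _)) ⟩
    0ℤ ℤ.+ (+ n ℤ.- (+ t ℤ.- + M)) ℤ.* (f ℤ.* c) ≡⟨ lemma₁ (+ n) (+ t) (+ M) f c ⟩
    f ℤ.* ((+ n ℤ.+ + M) ℤ.* c ℤ.- + t ℤ.* c)   ≡⟨ cong (f ℤ.*_) absorb ⟩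
    f ℤ.* (+ suc t ℤ.* c′)                       ≡⟨ lemma₂ f (+ suc t) c′ ⟩
    (+ suc t ℤ.* f) ℤ.* c′                       ≡⟨ cong (ℤ._* c′) (ℤ.pos-* (suc t) (t !)) ⟨
    + (suc t * t !) ℤ.* c′                       ≡⟨ ℤ.pos-* (suc t * t !) _ ⟨
    + (suc t * t ! * ((n + M) C suc t))          ∎
    where
    open ≡-Reasoning
    f = + (t !)
    c = + ((n + M) C t)
    c′ = + ((n + M) C suc t)
    lemma₁ : ∀ n t m f c → 0ℤ ℤ.+ (n ℤ.- (t ℤ.- m)) ℤ.* (f ℤ.* c) ≡
                           f ℤ.* ((n ℤ.+ m) ℤ.* c ℤ.- t ℤ.* c)
    lemma₁ = ring
    lemma₂ : ∀ x y z → x ℤ.* (y ℤ.* z) ≡ (y ℤ.* x) ℤ.* z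
    lemma₂ = ring
    lemma₃ : ∀ x y → x ≡ (x ℤ.+ y) ℤ.- y
    lemma₃ = ring
    absorb : (+ n ℤ.+ + M) ℤ.* c ℤ.- + t ℤ.* c ≡ + suc t ℤ.* c′
    absorb = begin
      + (n + M) ℤ.* c ℤ.- + t ℤ.* c
        ≡⟨ cong (ℤ._- + t ℤ.* c) (ℤ.pos-* (n + M) _) ⟨
      + ((n + M) * ((n + M) C t)) ℤ.- + t ℤ.* c
        ≡⟨ cong (λ x → + x ℤ.- + t ℤ.* c) (binomial-absorb (n + M) t) ⟨
      + (suc t * ((n + M) C suc t)) ℤ.+ + (t * ((n + M) C t)) ℤ.- + t ℤ.* c
        ≡⟨ cong₂ (λ x y → x ℤ.+ y ℤ.- + t ℤ.* c) (ℤ.pos-* (suc t) _) (ℤ.pos-* t _) ⟩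
      + suc t ℤ.* c′ ℤ.+ + t ℤ.* c ℤ.- + t ℤ.* c
        ≡⟨ lemma₃ (+ suc t ℤ.* c′) (+ t ℤ.* c) ⟨
      + suc t ℤ.* c′ ∎

  -- These are t! C(X+M,i) for i = t, ..., 0, matching increasing indices of the sequence:
  -- `binomialPoly i` brings i!, and the scalings raise it to the common factor t!.
  coefficients : ℕ → List Poly
  coefficients zero    = [ binomialPoly 0 ]
  coefficients (suc t) = binomialPoly (suc t) ∷ map (scale (+ suc t)) (coefficients t)

  length-coefficients : ∀ t → length (coefficients t) ≡ suc t
  length-coefficients zero    = refl
  length-coefficients (suc t) = cong suc
    (trans (length-map (scale (+ suc t)) (coefficients t)) (length-coefficients t))

  recur-coefficients : ∀ t n o (a : ℕ → ℕ) → o + t ≡ n + M →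
    recur (coefficients t) (+ n) (+_ ∘ a) o ≡ + (t ! * binomialSum t (n + M) a)
  recur-coefficients zero n o a eq = begin
    (1ℤ ℤ.+ + n ℤ.* 0ℤ) ℤ.* + a o ℤ.+ 0ℤ
      ≡⟨ cong₂ (λ z i → (1ℤ ℤ.+ z) ℤ.* + a i ℤ.+ 0ℤ)
               (ℤ.*-zeroʳ (+ n)) (trans (sym (ℕ.+-identityʳ o)) eq) ⟩
    1ℤ ℤ.* + a (n + M) ℤ.+ 0ℤ ≡⟨ ℤ.+-identityʳ _ ⟩
    1ℤ ℤ.* + a (n + M)        ≡⟨ ℤ.pos-* 1 (a (n + M)) ⟨
    + (1 * a (n + M))         ∎
    where open ≡-Reasoning
  recur-coefficients (suc t) n o a eq = begin
    eval (binomialPoly (suc t)) (+ n) ℤ.* + a o ℤ.+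
      recur (map (scale (+ suc t)) (coefficients t)) (+ n) (+_ ∘ a) (suc o)
      ≡⟨ cong₂ (λ x y → x ℤ.* + a o ℤ.+ y) (eval-binomialPoly (suc t) n)
           (trans (recur-scale (+ suc t) (coefficients t) (+ n) (+_ ∘ a) (suc o))
             (cong (+ suc t ℤ.*_)
               (recur-coefficients t n (suc o) a (trans (sym (ℕ.+-suc o t)) eq)))) ⟩
    + (suc t ! * c) ℤ.* + a o ℤ.+ + suc t ℤ.* + (t ! * Σg)
      ≡⟨ cong₂ ℤ._+_ (ℤ.pos-* (suc t ! * c) (a o)) (ℤ.pos-* (suc t) (t ! * Σg)) ⟨
    + (suc t ! * c * a o + suc t * (t ! * Σg))
      ≡⟨ cong +_ (lemma (suc t) (t !) c (a o) Σg) ⟩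
    + (suc t ! * (c * a o + Σg))
      ≡⟨ cong (λ i → + (suc t ! * (c * a i + Σg))) o≡ ⟩
    + (suc t ! * binomialSum (suc t) (n + M) a) ∎
    where
    open ≡-Reasoning
    c = (n + M) C suc t
    Σg = binomialSum t (n + M) a
    o≡ : o ≡ n + M ∸ suc t
    o≡ = trans (sym (ℕ.m+n∸n≡m o (suc t))) (cong (_∸ suc t) eq)
    lemma : ∀ u f c x s → u * f * c * x + u * (f * s) ≡ u * f * (c * x + s)
    lemma = solve-∀

module CountCapacities (M : ℕ) where
  open Capacities M
  open Recogniser recogniser using (count)

  binomialSum-at-0 : ∀ t g → binomialSum t 0 g ≡ g 0
  binomialSum-at-0 zero    g = refl
  binomialSum-at-0 (suc t) g rewrite k>n⇒nCk≡0 {0} {suc t} (s≤s z≤n) = binomialSum-at-0 t g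

  -- The i-th summand counts the words in which i of the n remaining elements
  -- join the first block.
  count-∷ : ∀ t cs n → count (t ∷ cs) n ≡ binomialSum t n (count cs)

  -- Mutual with `count-∷`, descending in `n`: a skipped block stays at the front of each successor
  -- state, where `count-∷` applies again.
  count-skip : ∀ t cs n → sum (map (λ (_ , s) → count s n) (map (skip t) (δ cs))) ≡
                          binomialSum t n (count cs ∘ suc)
  count-skip t cs n = begin
    sum (map (λ (_ , s) → count s n) (map (skip t) (δ cs)))
      ≡⟨ cong sum (map-∘ (δ cs)) ⟨
    sum (map (λ (_ , s) → count (t ∷ s) n) (δ cs))
      ≡⟨ cong sum (map-cong (λ (_ , s) → count-∷ t s n) (δ cs)) ⟩
    sum (map (λ (_ , s) → binomialSum t n (count s)) (δ cs))
      ≡⟨ binomialSum-sum t n (λ (_ , s) → count s) (δ cs) ⟨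
    binomialSum t n (count cs ∘ suc) ∎
    where open ≡-Reasoning

  count-∷ t       cs zero    = sym (binomialSum-at-0 t (count cs))
  count-∷ zero    cs (suc n) = count-skip zero cs n
  count-∷ (suc t) cs (suc n) = trans
    (cong₂ _+_ (count-∷ t cs n) (count-skip (suc t) cs n))
    (sym (binomialSum-suc t n (count cs)))

pRecursive-capacities : ∀ M → PRecursive (+_ ∘ Recogniser.count (Capacities.recogniser M) [])
pRecursive-capacities zero    =
  -- Here m = 1: every nonempty partition contains the pattern, the sequence is 1, 0, 0, ... and E
  -- annihilates it.
  cRecursive⇒pRecursive (+_ ∘ Recogniser.count (Capacities.recogniser 0) []) [ 0ℤ ] λ n →
  cong (ℤ._+ 0ℤ) (ℤ.*-zeroˡ (+ Recogniser.count (Capacities.recogniser 0) [] n))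
pRecursive-capacities (suc t) =
  -- With N = n + t + 1 the lowest term of the sum is a(N-t) = a(n+1), so a(n) gets the zero
  -- polynomial `[]`; the final -t! belongs to a(N+1).
  pRecursive (+_ ∘ a) ([] ∷ coefficients t ∷ʳ [ ℤ.- + (t !) ])
    (there (Any.++⁺ʳ (coefficients t) (here λ { (eq ∷ _) → t!≢0 eq }))) recurrence
  where
  open Recogniser (Capacities.recogniser (suc t)) using (count)
  open CountCapacities (suc t)
  open BinomialRecurrence (suc t)
  open ≡-Reasoning

  a : ℕ → ℕ
  a = count []

  t!≢0 : ℤ.- + (t !) ≢ 0ℤ
  t!≢0 eq = ℕ.n>0⇒n≢0 (ℕ.1≤n! t) (ℤ.+-injective (ℤ.neg-injective {j = + 0} eq))

  -- The first element opens a block with room for `t` more, and `count-∷` splits off the elements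
  -- that join it.
  a-suc : ∀ N → a (suc N) ≡ binomialSum t N a
  a-suc N = trans (ℕ.+-identityʳ _) (count-∷ t [] N)

  recurrence : ∀ n → recur ([] ∷ coefficients t ∷ʳ [ ℤ.- + (t !) ]) (+ n) (+_ ∘ a) n ≡ 0ℤ
  recurrence n = begin
    0ℤ ℤ.* + a n ℤ.+ recur (coefficients t ∷ʳ [ ℤ.- + (t !) ]) (+ n) (+_ ∘ a) (suc n)
      ≡⟨ ℤ.+-identityˡ _ ⟩
    recur (coefficients t ∷ʳ [ ℤ.- + (t !) ]) (+ n) (+_ ∘ a) (suc n)
      ≡⟨ recur-∷ʳ (coefficients t) [ ℤ.- + (t !) ] (+ n) (+_ ∘ a) (suc n) ⟩
    recur (coefficients t) (+ n) (+_ ∘ a) (suc n) ℤ.+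
      last ℤ.* + a (suc (n + length (coefficients t)))
      ≡⟨ cong₂ (λ x l → x ℤ.+ last ℤ.* + a (suc (n + l)))
           (trans (recur-coefficients t n (suc n) a (sym (ℕ.+-suc n t))) (ℤ.pos-* (t !) _))
           (length-coefficients t) ⟩
    + (t !) ℤ.* + binomialSum t (n + suc t) a ℤ.+ last ℤ.* + a (suc (n + suc t))
      ≡⟨ cong (λ x → + (t !) ℤ.* + x ℤ.+ last ℤ.* + a (suc (n + suc t)))
           (a-suc (n + suc t)) ⟨
    + (t !) ℤ.* + a (suc (n + suc t)) ℤ.+ last ℤ.* + a (suc (n + suc t))
      ≡⟨ lemma (+ (t !)) (+ n) (+ a (suc (n + suc t))) ⟩
    0ℤ ∎
    where
    last : ℤ
    last = ℤ.- + (t !) ℤ.+ + n ℤ.* 0ℤ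

    lemma : ∀ f n x → f ℤ.* x ℤ.+ (ℤ.- f ℤ.+ n ℤ.* 0ℤ) ℤ.* x ≡ 0ℤ
    lemma = ring

-- From restricted growth functions back to partitions

ρ-singletons : ∀ m → ρ (singletons m) ≡ map suc (upTo m)
ρ-singletons m = begin
  ρ (singletons m)           ≡⟨ tabulate-cong (λ x → cong suc (index-tabulate⁺ ⁅_⁆ x _)) ⟩
  tabulate {n = m} (suc ∘ toℕ) ≡⟨ applyUpTo≡tabulate suc m ⟨
  applyUpTo suc m            ≡⟨ map-upTo suc m ⟨
  map suc (upTo m)           ∎
  where
  open ≡-Reasoning
  applyUpTo≡tabulate : ∀ {A : Set} (f : ℕ → A) m → applyUpTo f m ≡ tabulate {n = m} (f ∘ toℕ)
  applyUpTo≡tabulate f zero    = refl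
  applyUpTo≡tabulate f (suc m) = cong (f 0 ∷_) (applyUpTo≡tabulate (f ∘ suc) m)

ρ-oneBlock : ∀ m .{{_ : NonZero m}} → ρ (oneBlock m) ≡ replicate m 1
ρ-oneBlock (suc m) = cong (1 ∷_) (tabulate-const m)
  where
  tabulate-const : ∀ m → tabulate {n = m} (λ _ → 1) ≡ replicate m 1
  tabulate-const zero    = refl
  tabulate-const (suc m) = cong (1 ∷_) (tabulate-const m)

module _ {Bad : List ℕ → Set} (A : Recogniser Bad) where
  open Recogniser A

  recogniser⇒pRecursive : ∀ {m r} (π : Partition m) → ρ π ≡ r → Detects r Bad →
                          PRecursive (+_ ∘ count start) → PRecursive-#R π
  recogniser⇒pRecursive π refl det rec = count start , #R≡count A π det , rec

-- Avoidance sees a pattern only through `ρ`. Asking just for the value of `ρ π` lets one proof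
-- serve both `singletons` and an arbitrary partition of [3] with this restricted growth function.
pRecursive-12⋯m : ∀ {m} M (π : Partition m) → ρ π ≡ map suc (upTo (suc M)) → PRecursive-#R π
pRecursive-12⋯m M π eq = recogniser⇒pRecursive (recogniser-increasing M) π eq
  (detects-increasing (suc M)) (CountIncreasing.pRecursive-increasing M)

pRecursive-1⋯1 : ∀ {m} M (π : Partition m) → ρ π ≡ replicate (suc M) 1 → PRecursive-#R π
pRecursive-1⋯1 M π eq = recogniser⇒pRecursive (Capacities.recogniser M) π eq
  (detects-constant M) (pRecursive-capacities M)

pRecursive-oneOldLetter : ∀ {Bad m r} → OneOldLetter Bad → (π : Partition m) → ρ π ≡ r →
                          Detects r Bad → PRecursive-#R π
pRecursive-oneOldLetter L π eq det = recogniser⇒pRecursive (OneOldLetter.recogniser L) π eq det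
  (powersOf2 (Recogniser.count (OneOldLetter.recogniser L) 0)
    λ n → trans (ℕ.+-identityʳ _) (count-oneOldLetter L 0 n))

restricted-growth-3 : ∀ {x y z} → RGF 0 (x ∷ y ∷ z ∷ []) →
  let w = map suc (x ∷ y ∷ z ∷ []) in
  w ≡ 1 ∷ 1 ∷ 1 ∷ [] ⊎ w ≡ 1 ∷ 1 ∷ 2 ∷ [] ⊎ w ≡ 1 ∷ 2 ∷ 1 ∷ [] ⊎ w ≡ 1 ∷ 2 ∷ 2 ∷ [] ⊎
  w ≡ 1 ∷ 2 ∷ 3 ∷ []
restricted-growth-3 (z≤n , z≤n     , z≤n , _)               = inj₁ refl
restricted-growth-3 (z≤n , z≤n     , s≤s z≤n , _)           = inj₂ (inj₁ refl)
restricted-growth-3 (z≤n , s≤s z≤n , z≤n , _)               = inj₂ (inj₂ (inj₁ refl))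
restricted-growth-3 (z≤n , s≤s z≤n , s≤s z≤n , _)           = inj₂ (inj₂ (inj₂ (inj₁ refl)))
restricted-growth-3 (z≤n , s≤s z≤n , s≤s (s≤s z≤n) , _)     = inj₂ (inj₂ (inj₂ (inj₂ refl)))

pRecursive-3 : (π : Partition 3) → PRecursive-#R π
pRecursive-3 π with restricted-growth-3 (rgf⁺ (word π) (word-ordered π))
... | inj₁ eq = pRecursive-1⋯1 2 π eq
... | inj₂ (inj₁ eq) = recogniser⇒pRecursive recogniser-112 π eq detects-112
  (powersOf2 (Recogniser.count recogniser-112 (increasing 0))
    λ n → trans (ℕ.+-identityʳ _) (Count112.count-increasing n))
... | inj₂ (inj₂ (inj₁ eq)) = pRecursive-oneOldLetter oneOldLetter-121 π eq detects-121
... | inj₂ (inj₂ (inj₂ (inj₁ eq))) = pRecursive-oneOldLetter oneOldLetter-122 π eq detects-122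
... | inj₂ (inj₂ (inj₂ (inj₂ eq))) = pRecursive-12⋯m 2 π eq

theorem4p4 : (∀ (m : ℕ) .{{_ : NonZero m}} →
    PRecursive-#R (singletons m) × PRecursive-#R (oneBlock m))
    × (∀ (π : Partition 3) → PRecursive-#R π)
theorem4p4 =
  (λ { (suc M) → pRecursive-12⋯m M (singletons (suc M)) (ρ-singletons (suc M))
               , pRecursive-1⋯1 M (oneBlock (suc M)) (ρ-oneBlock (suc M)) })
  , pRecursive-3
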